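{- Let $d$ and $k$ be integers with $2\le k\le d-1$. Then $\underline{sa}_d^s(d+k)$ satisfies the following upper bounds. (1) For $2 \leq k \leq \lfloor (2d-2)/3 \rfloor$ we have $$\underline{sa}_d^s(d+k) \leq \frac{d(d+1)}{2}+k-1 = \Theta(d^2).$$ (2) For $\lceil (2d-2)/3 \rceil \leq k \leq d-1$ we have $$\underline{sa}_d^s(d+k) \leq k + \frac{(d+k)(d+k-1)}{2} - \frac{2k(2k-1)}{2} = k + \frac{(d-k)(d+3k-1)}{2} = \Theta((d-k)d).$$
   Context: Let $X=\{x_1,\dots,x_n\}\subset\mathbb{R}^d$ be a finite set (with $x_i\neq x_j$ for $i\ne j$) whose affine hull is $\mathbb{R}^d$, and let $P=\operatorname{conv}X$. Two distinct points $x_i,x_j\in X$ are strictly antipodal (in $X$) if there are different parallel supporting hyperplanes $H',H''$ of $P$ with $X\cap H'=\{x_i\}$ and $X\cap H''=\{x_j\}$. $sa(X)$ is the number of (unordered) strictly antipodal pairs of $X$. $X$ is in strictly convex position if $X=\operatorname{vert}P$ (the vertex set of $P$). $\mathcal{C}_d^s(n)$ is the family of all $X\subset\mathbb{R}^d$ with $|X|=n$, $\operatorname{aff}X=\mathbb{R}^d$, $X$ in strictly convex position, and $\underline{sa}_d^s(n):=\min\{sa(X)\mid X\in\mathcal{C}_d^s(n)\}$. The $\Theta(\cdot)$ relations mean that the displayed explicit expressions lie between positive absolute constant multiples of the indicated quantities, over the stated range of $d,k$. -}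

module Defs where

open import Level using (0ℓ)
open import Axiom.ExcludedMiddle using (ExcludedMiddle)
open import Algebra.Bundles.Raw using (RawMonoid)
import Algebra.Definitions.RawMonoid as RawMonoidOps
open import Data.Fin as Fin using (Fin)
open import Data.Integer using (+_)
open import Data.List using (List; length; filter; cartesianProduct; allFin)
open import Data.Nat as ℕ using (ℕ)
import Data.Nat.DivMod as ℕ
import Data.Nat.Properties as ℕ
open import Data.Product using (Σ; ∃; ∃₂; _×_; _,_)
open import Data.Rational as ℚ using (ℚ; 0ℚ; 1ℚ; ½; ∣_∣)
import Data.Rational.Properties as ℚ
open import Data.Rational.Solver using (module +-*-Solver)
open import Data.Sum using (_⊎_)
open import Data.Vec.Functional using (Vector)
open import Function using (_⇔_)
open import Relation.Binary.PropositionalEquality using (_≡_; refl; sym; cong; cong₂; subst)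
open import Relation.Nullary using (¬_)

-- The real numbers: Cauchy sequences of rationals, with equality the setoid
-- relation _≈_ ("the difference tends to 0").

Cauchy : (ℕ → ℚ) → Set
Cauchy x = ∀ ε → 0ℚ ℚ.< ε → ∃ λ N → ∀ m n → N ℕ.≤ m → N ℕ.≤ n → ∣ x m ℚ.- x n ∣ ℚ.< ε

record ℝ : Set where
  constructor real
  field
    seq    : ℕ → ℚ
    cauchy : Cauchy seq

open ℝ public

infix 4 _≈_ _≤_

_≈_ : ℝ → ℝ → Set
x ≈ y = ∀ ε → 0ℚ ℚ.< ε → ∃ λ N → ∀ n → N ℕ.≤ n → ∣ seq x n ℚ.- seq y n ∣ ℚ.< ε

_≤_ : ℝ → ℝ → Set
x ≤ y = ∀ ε → 0ℚ ℚ.< ε → ∃ λ N → ∀ n → N ℕ.≤ n → seq x n ℚ.< seq y n ℚ.+ ε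

private
  open ℚ.≤-Reasoning

private abstract
  half-pos : ∀ {ε} → 0ℚ ℚ.< ε → 0ℚ ℚ.< ½ ℚ.* ε
  half-pos {ε} 0<ε = ℚ.positive⁻¹ (½ ℚ.* ε) {{ℚ.pos*pos⇒pos ½ ε {{ℚ.positive 0<ε}}}}

  halves : ∀ ε → ½ ℚ.* ε ℚ.+ ½ ℚ.* ε ≡ ε
  halves ε = begin-equality
    ½ ℚ.* ε ℚ.+ ½ ℚ.* ε ≡⟨ ℚ.*-distribʳ-+ ε ½ ½ ⟨
    1ℚ ℚ.* ε             ≡⟨ ℚ.*-identityˡ ε ⟩
    ε                    ∎

  add-regroup : ∀ a b c d → (a ℚ.+ b) ℚ.- (c ℚ.+ d) ≡ (a ℚ.- c) ℚ.+ (b ℚ.- d)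
  add-regroup = solve 4 (λ a b c d → (a :+ b) :- (c :+ d) := (a :- c) :+ (b :- d)) refl
    where open +-*-Solver

  mul-regroup : ∀ a b c d → a ℚ.* b ℚ.- c ℚ.* d ≡ a ℚ.* (b ℚ.- d) ℚ.+ d ℚ.* (a ℚ.- c)
  mul-regroup = solve 4 (λ a b c d → a :* b :- c :* d := a :* (b :- d) :+ d :* (a :- c)) refl
    where open +-*-Solver

  split : ∀ a b → a ≡ (a ℚ.- b) ℚ.+ b
  split = solve 2 (λ a b → a := (a :- b) :+ b) refl
    where open +-*-Solver

  const-cauchy : ∀ q → Cauchy (λ _ → q)
  const-cauchy q ε 0<ε = 0 , λ _ _ _ _ → subst (ℚ._< ε) (cong ∣_∣ (sym (ℚ.+-inverseʳ q))) 0<ε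

  +-cauchy : ∀ x y → Cauchy x → Cauchy y → Cauchy (λ n → x n ℚ.+ y n)
  +-cauchy x y cx cy ε 0<ε
    with N₁ , h₁ ← cx (½ ℚ.* ε) (half-pos 0<ε)
       | N₂ , h₂ ← cy (½ ℚ.* ε) (half-pos 0<ε)
    = N₁ ℕ.⊔ N₂ , λ m n m≥ n≥ → begin-strict
      ∣ (x m ℚ.+ y m) ℚ.- (x n ℚ.+ y n) ∣     ≡⟨ cong ∣_∣ (add-regroup (x m) (y m) (x n) (y n)) ⟩
      ∣ (x m ℚ.- x n) ℚ.+ (y m ℚ.- y n) ∣     ≤⟨ ℚ.∣p+q∣≤∣p∣+∣q∣ (x m ℚ.- x n) (y m ℚ.- y n) ⟩
      ∣ x m ℚ.- x n ∣ ℚ.+ ∣ y m ℚ.- y n ∣     <⟨ ℚ.+-mono-<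
                                                   (h₁ m n (ℕ.m⊔n≤o⇒m≤o N₁ N₂ m≥) (ℕ.m⊔n≤o⇒m≤o N₁ N₂ n≥))
                                                   (h₂ m n (ℕ.m⊔n≤o⇒n≤o N₁ N₂ m≥) (ℕ.m⊔n≤o⇒n≤o N₁ N₂ n≥)) ⟩
      ½ ℚ.* ε ℚ.+ ½ ℚ.* ε                    ≡⟨ halves ε ⟩
      ε                                       ∎

  bounded : ∀ x → Cauchy x → ∃₂ λ B N → 0ℚ ℚ.< B × ∀ n → N ℕ.≤ n → ∣ x n ∣ ℚ.≤ B
  bounded x cx with N , h ← cx 1ℚ (ℚ.positive⁻¹ 1ℚ)
    = 1ℚ ℚ.+ ∣ x N ∣ , N
    , ℚ.+-mono-<-≤ (ℚ.positive⁻¹ 1ℚ) (ℚ.0≤∣p∣ (x N))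
    , λ n n≥ → begin
      ∣ x n ∣                        ≡⟨ cong ∣_∣ (split (x n) (x N)) ⟩
      ∣ (x n ℚ.- x N) ℚ.+ x N ∣      ≤⟨ ℚ.∣p+q∣≤∣p∣+∣q∣ (x n ℚ.- x N) (x N) ⟩
      ∣ x n ℚ.- x N ∣ ℚ.+ ∣ x N ∣    ≤⟨ ℚ.+-mono-≤ (ℚ.<⇒≤ (h n N n≥ ℕ.≤-refl)) ℚ.≤-refl ⟩
      1ℚ ℚ.+ ∣ x N ∣                 ∎

  small : ∀ {ε B} → 0ℚ ℚ.< ε → 0ℚ ℚ.< B →
          ∃ λ δ → 0ℚ ℚ.< δ × ∀ p q → ∣ p ∣ ℚ.≤ B → ∣ q ∣ ℚ.< δ → ∣ p ℚ.* q ∣ ℚ.< ε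
  small {ε} {B} 0<ε 0<B = δ , ℚ.positive⁻¹ δ , λ p q p≤B q<δ → begin-strict
      ∣ p ℚ.* q ∣        ≡⟨ ℚ.∣p*q∣≡∣p∣*∣q∣ p q ⟩
      ∣ p ∣ ℚ.* ∣ q ∣    ≤⟨ ℚ.*-monoʳ-≤-nonNeg ∣ q ∣ {{ℚ.∣-∣-nonNeg q}} p≤B ⟩
      B ℚ.* ∣ q ∣        <⟨ ℚ.*-monoʳ-<-pos B q<δ ⟩
      B ℚ.* (B⁻¹ ℚ.* ε)  ≡⟨ ℚ.*-assoc B B⁻¹ ε ⟨
      B ℚ.* B⁻¹ ℚ.* ε    ≡⟨ cong (ℚ._* ε) (ℚ.*-inverseʳ B) ⟩
      1ℚ ℚ.* ε           ≡⟨ ℚ.*-identityˡ ε ⟩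
      ε                  ∎
    where
    instance
      B-pos : ℚ.Positive B
      B-pos = ℚ.positive 0<B
      ε-pos : ℚ.Positive ε
      ε-pos = ℚ.positive 0<ε
      B-nonZero : ℚ.NonZero B
      B-nonZero = ℚ.pos⇒nonZero B
    B⁻¹ δ : ℚ
    B⁻¹ = ℚ.1/ B
    δ   = B⁻¹ ℚ.* ε
    instance
      B⁻¹-pos : ℚ.Positive B⁻¹
      B⁻¹-pos = ℚ.1/pos⇒pos B
      δ-pos : ℚ.Positive δ
      δ-pos = ℚ.pos*pos⇒pos B⁻¹ ε

  mul-close : ∀ a b c d {η} → ∣ a ℚ.* (b ℚ.- d) ∣ ℚ.< η → ∣ d ℚ.* (a ℚ.- c) ∣ ℚ.< η →
              ∣ a ℚ.* b ℚ.- c ℚ.* d ∣ ℚ.< η ℚ.+ η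
  mul-close a b c d {η} p q = begin-strict
    ∣ a ℚ.* b ℚ.- c ℚ.* d ∣                            ≡⟨ cong ∣_∣ (mul-regroup a b c d) ⟩
    ∣ a ℚ.* (b ℚ.- d) ℚ.+ d ℚ.* (a ℚ.- c) ∣            ≤⟨ ℚ.∣p+q∣≤∣p∣+∣q∣ (a ℚ.* (b ℚ.- d)) (d ℚ.* (a ℚ.- c)) ⟩
    ∣ a ℚ.* (b ℚ.- d) ∣ ℚ.+ ∣ d ℚ.* (a ℚ.- c) ∣        <⟨ ℚ.+-mono-< p q ⟩
    η ℚ.+ η                                            ∎

  *-cauchy : ∀ x y → Cauchy x → Cauchy y → Cauchy (λ n → x n ℚ.* y n)
  *-cauchy x y cx cy ε 0<ε =
    let Bx , Nx , 0<Bx , bx = bounded x cx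
        By , Ny , 0<By , by = bounded y cy
        δ₁ , 0<δ₁ , s₁ = small (half-pos 0<ε) 0<Bx
        δ₂ , 0<δ₂ , s₂ = small (half-pos 0<ε) 0<By
        N₁ , h₁ = cy δ₁ 0<δ₁
        N₂ , h₂ = cx δ₂ 0<δ₂
        L = Nx ℕ.⊔ N₁
        R = Ny ℕ.⊔ N₂
    in L ℕ.⊔ R , λ m n m≥ n≥ →
      let m≥L = ℕ.m⊔n≤o⇒m≤o L R m≥
          n≥L = ℕ.m⊔n≤o⇒m≤o L R n≥
          m≥R = ℕ.m⊔n≤o⇒n≤o L R m≥
          n≥R = ℕ.m⊔n≤o⇒n≤o L R n≥
      in subst (∣ x m ℚ.* y m ℚ.- x n ℚ.* y n ∣ ℚ.<_) (halves ε)
           (mul-close (x m) (y m) (x n) (y n)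
             (s₁ (x m) (y m ℚ.- y n) (bx m (ℕ.m⊔n≤o⇒m≤o Nx N₁ m≥L))
               (h₁ m n (ℕ.m⊔n≤o⇒n≤o Nx N₁ m≥L) (ℕ.m⊔n≤o⇒n≤o Nx N₁ n≥L)))
             (s₂ (y n) (x m ℚ.- x n) (by n (ℕ.m⊔n≤o⇒m≤o Ny N₂ n≥R))
               (h₂ m n (ℕ.m⊔n≤o⇒n≤o Ny N₂ m≥R) (ℕ.m⊔n≤o⇒n≤o Ny N₂ n≥R))))

infixl 6 _+_
infixl 7 _*_

_+_ : ℝ → ℝ → ℝ
seq    (x + y) n = seq x n ℚ.+ seq y n
cauchy (x + y)   = +-cauchy (seq x) (seq y) (cauchy x) (cauchy y)

_*_ : ℝ → ℝ → ℝ
seq    (x * y) n = seq x n ℚ.* seq y n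
cauchy (x * y)   = *-cauchy (seq x) (seq y) (cauchy x) (cauchy y)

fromℚ : ℚ → ℝ
fromℚ q = real (λ _ → q) (const-cauchy q)

0ℝ 1ℝ : ℝ
0ℝ = fromℚ 0ℚ
1ℝ = fromℚ 1ℚ

+-rawMonoid : RawMonoid 0ℓ 0ℓ
+-rawMonoid = record { Carrier = ℝ ; _≈_ = _≈_ ; _∙_ = _+_ ; ε = 0ℝ }

open RawMonoidOps +-rawMonoid public using (sum)

Point : ℕ → Set
Point d = Vector ℝ d

infix 4 _≋_

_≋_ : ∀ {d} → Point d → Point d → Set
p ≋ q = ∀ c → p c ≈ q c

dot : ∀ {d} → Point d → Point d → ℝ
dot a y = sum λ c → a c * y c

-- A finite subset X of ℝᵈ is given as a family of points; that the points are
-- pairwise distinct is a field of Config below.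
Family : ℕ → ℕ → Set
Family d n = Fin n → Point d

combination : ∀ {d n} → Vector ℝ n → Family d n → Point d
combination w X c = sum λ i → w i * X i c

_∈aff_ : ∀ {d n} → Point d → Family d n → Set
y ∈aff X = ∃ λ w → sum w ≈ 1ℝ × y ≋ combination w X

_∈conv_ : ∀ {d n} → Point d → Family d n → Set
y ∈conv X = ∃ λ w → (∀ i → 0ℝ ≤ w i) × sum w ≈ 1ℝ × y ≋ combination w X

record Hyperplane (d : ℕ) : Set where
  field
    normal   : Point d
    offset   : ℝ
    normal≉0 : ¬ (∀ c → normal c ≈ 0ℝ)

open Hyperplane public

_∈ᴴ_ : ∀ {d} → Point d → Hyperplane d → Set
y ∈ᴴ H = dot (normal H) y ≈ offset H

Parallel : ∀ {d} → Hyperplane d → Hyperplane d → Set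
Parallel H H′ = ∃ λ t → ¬ (t ≈ 0ℝ) × (∀ c → normal H c ≈ t * normal H′ c)

-- Inequality as point sets; (normal, offset) is only determined up to scaling.
Different : ∀ {d} → Hyperplane d → Hyperplane d → Set
Different H H′ = ¬ (∀ y → y ∈ᴴ H ⇔ y ∈ᴴ H′)

-- H supports conv X: they meet, and conv X lies in one closed side of H.
Supports : ∀ {d n} → Hyperplane d → Family d n → Set
Supports H X =
  (∃ λ y → y ∈conv X × y ∈ᴴ H) ×
  ((∀ y → y ∈conv X → dot (normal H) y ≤ offset H) ⊎
   (∀ y → y ∈conv X → offset H ≤ dot (normal H) y))

-- X ∩ H = {p}
MeetsOnlyAt : ∀ {d n} → Family d n → Hyperplane d → Point d → Set
MeetsOnlyAt X H p = p ∈ᴴ H × (∃ λ i → X i ≋ p) × (∀ i → X i ∈ᴴ H → X i ≋ p)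

StrictlyAntipodal : ∀ {d n} → Family d n → Fin n → Fin n → Set
StrictlyAntipodal X i j = ¬ (X i ≋ X j) ×
  ∃₂ λ H′ H″ → Different H′ H″ × Parallel H′ H″ × Supports H′ X × Supports H″ X ×
               MeetsOnlyAt X H′ (X i) × MeetsOnlyAt X H″ (X j)

-- p is a vertex of conv X: {p} is the intersection of conv X with a supporting
-- hyperplane.
IsVertex : ∀ {d n} → Family d n → Point d → Set
IsVertex X p = ∃ λ H → Supports H X × (∀ y → (y ∈conv X × y ∈ᴴ H) ⇔ y ≋ p)

-- The family 𝒞ˢ_d(n).
record Config (d n : ℕ) : Set where
  field
    points         : Family d n
    distinct       : ∀ i j → points i ≋ points j → i ≡ j
    full           : ∀ y → y ∈aff points
    strictlyConvex : ∀ p → (∃ λ i → p ≋ points i) ⇔ IsVertex points p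

open Config public

-- Counting real-geometric configurations is classical, so excluded middle is an
-- explicit argument. Unordered pairs are represented by i < j.
sa : ∀ {d n} → ExcludedMiddle 0ℓ → Family d n → ℕ
sa {d} {n} em X =
  length (filter (λ (i , j) → em {i Fin.< j × StrictlyAntipodal X i j})
                 (cartesianProduct (allFin n) (allFin n)))

IsMinimum : (ℕ → Set) → ℕ → Set
IsMinimum S m = S m × (∀ l → S l → m ℕ.≤ l)

-- m is the minimum of sa(X) over X in 𝒞ˢ_d(n).
IsMinSa : ExcludedMiddle 0ℓ → (d n m : ℕ) → Set
IsMinSa em d n = IsMinimum λ l → Σ (Config d n) λ C → sa em (points C) ≡ l

⌊_/3⌋ ⌈_/3⌉ : ℕ → ℕ
⌊ m /3⌋ = m ℕ./ 3
⌈ m /3⌉ = (m ℕ.+ 2) ℕ./ 3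

-- On these ranges no truncated subtraction below truncates and every halving is
-- exact.
Range₁ Range₂ : ℕ → ℕ → Set
Range₁ d k = 2 ℕ.≤ k × k ℕ.≤ d ℕ.∸ 1 × k ℕ.≤ ⌊ 2 ℕ.* d ℕ.∸ 2 /3⌋
Range₂ d k = 2 ℕ.≤ k × k ℕ.≤ d ℕ.∸ 1 × ⌈ 2 ℕ.* d ℕ.∸ 2 /3⌉ ℕ.≤ k

bound₁ bound₂ bound₂′ : ℕ → ℕ → ℕ
bound₁ d k = d ℕ.* (d ℕ.+ 1) ℕ./ 2 ℕ.+ k ℕ.∸ 1
bound₂ d k =
  k ℕ.+ (d ℕ.+ k) ℕ.* (d ℕ.+ k ℕ.∸ 1) ℕ./ 2 ℕ.∸ 2 ℕ.* k ℕ.* (2 ℕ.* k ℕ.∸ 1) ℕ./ 2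
bound₂′ d k = k ℕ.+ (d ℕ.∸ k) ℕ.* (d ℕ.+ 3 ℕ.* k ℕ.∸ 1) ℕ./ 2

fromℕ : ℕ → ℚ
fromℕ m = + m ℚ./ 1

Θ-on : (ℕ → ℕ → Set) → (f g : ℕ → ℕ → ℕ) → Set
Θ-on R f g = ∃₂ λ c C → 0ℚ ℚ.< c × 0ℚ ℚ.< C ×
  ∀ d k → R d k →
    c ℚ.* fromℕ (g d k) ℚ.≤ fromℕ (f d k) × fromℕ (f d k) ℚ.≤ C ℚ.* fromℕ (g d k)

{-# OPTIONS --safe #-}

-- Each upper bound comes from one configuration whose points are the unique maximisers, by a
-- margin of at least 1, of explicit linear functionals; hence they are its vertices. If x and y
-- are strictly antipodal, some linear functional f has its minimum over X at x only and its
-- maximum at y.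
--
-- Part 1. Take a = 0, b_j = d e_j (j ≤ d) and y_i = (1,…,1) + e_i (i < k), so the y_i lie just
-- beyond the facet conv {b_j} of a simplex. The relation d y_i + a = Σ b_j + b_i forbids that f
-- is minimal at y_i only and maximal at some b_j. If f is minimal at y_i and maximal at y_j, then
-- d f_i ≥ f(y_i) and d f_j ≤ f(y_j) give d (f_j - f_i) ≤ f_j - f_i, hence f(y_i) = f(y_j). So y_i
-- can only be paired with a, which leaves at most d(d+1)/2 + (k-1) pairs.
--
-- Part 2. Take e_1,…,e_d together with -e_c for the last k coordinates c: an iterated pyramid
-- over a cross-polytope. If s, t, -s, -t ∈ X and f is minimal at s only and maximal at t, then
-- f(-t) ≤ f(s) because f(-s) ≤ f(t), so -t = s: the 2k symmetric points contribute only k pairs.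
module Submission where

open import Level using (0ℓ)
open import Axiom.ExcludedMiddle using (ExcludedMiddle)
open import Algebra.Bundles using (CommutativeRing; Monoid)
open import Data.Bool using (true; false)
open import Data.Fin as Fin using (Fin; zero; suc; toℕ; splitAt; join; _↑ˡ_; _↑ʳ_)
import Data.Fin.Properties as Fin
open import Data.Integer using (+_)
import Data.Integer as ℤ
import Data.Integer.Properties as ℤ
open import Data.List using (List; []; _∷_; _++_; length; filter; map; tabulate; cartesianProduct; allFin)
import Data.List.Properties as List
import Data.List.Relation.Unary.All.Properties as All
open import Data.Nat as ℕ using (ℕ; zero; suc; s≤s; z≤n; _∸_; _/_)
open import Data.Nat.DivMod using (m*n/n≡m)
open import Data.Nat.Induction using (<-rec)
import Data.Nat.Properties as ℕ
open import Data.Nat.Solver using () renaming (module +-*-Solver to ℕ-Solver)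
open import Algebra.Properties.CommutativeMonoid.Sum ℕ.+-0-commutativeMonoid using () renaming (sum to sumℕ)
open import Data.Product using (∃; _×_; _,_; proj₁; proj₂)
open import Data.Rational as ℚ using (ℚ; 0ℚ; 1ℚ; ½; ∣_∣)
import Data.Rational.Properties as ℚ
open import Data.Rational.Solver using () renaming (module +-*-Solver to ℚ-Solver)
import Data.Rational.Unnormalised as ℚᵘ
import Data.Rational.Unnormalised.Properties as ℚᵘ
open import Data.Sum as Sum using (_⊎_; inj₁; inj₂)
import Data.Sum.Properties as Sum
open import Data.Vec.Functional using (Vector)
open import Function using (_∘_; id; mk⇔; module Equivalence)
open import Relation.Binary.Bundles using (Poset)
open import Relation.Binary.Definitions using (DecidableEquality)
open import Relation.Binary.PropositionalEquality as ≡ using (_≡_; _≢_)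
open import Relation.Binary.Structures using (IsPartialOrder)
open import Relation.Nullary using (¬_; yes; no; contradiction; does)
open import Relation.Nullary.Decidable using (decidable-stable)
open import Relation.Unary using (Decidable)

-- Convex geometry over a totally ordered ring

module _ {c ℓ} (M : Monoid c ℓ) where
  open Monoid M
  open import Algebra.Properties.Monoid.Sum M using (sum)

  -- Stated over an arbitrary monoid because it serves twice: for sums of ring elements and for row
  -- counts in the natural numbers.
  sum-splitAt : ∀ m {n} (f : Fin m ⊎ Fin n → Carrier) →
    sum (f ∘ splitAt m) ≈ sum (f ∘ inj₁) ∙ sum (f ∘ inj₂)
  sum-splitAt zero    f = sym (identityˡ _)
  sum-splitAt (suc m) f = trans (∙-congˡ (sum-splitAt m (f ∘ Sum.map₁ suc))) (sym (assoc _ _ _))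

-- The structure of the reals on which the geometry rests. Totality enters as `sign`, since
-- comparing x with y amounts to the sign of y - x. There is no division, so constructions that
-- divide take the inverse as an argument.
record TotallyOrderedRing : Set₁ where
  field
    commutativeRing : CommutativeRing 0ℓ 0ℓ
  open CommutativeRing commutativeRing public
  infix 4 _≤_
  field
    _≤_            : Carrier → Carrier → Set
    isPartialOrder : IsPartialOrder _≈_ _≤_
    +-mono-≤       : ∀ {x x′ y y′} → x ≤ x′ → y ≤ y′ → x + y ≤ x′ + y′
    *-nonneg       : ∀ {x y} → 0# ≤ x → 0# ≤ y → 0# ≤ x * y
    sign           : ∀ x → 0# ≤ x ⊎ x ≤ 0#
    1≰0            : ¬ 1# ≤ 0#

  poset : Poset 0ℓ 0ℓ 0ℓ
  poset = record { isPartialOrder = isPartialOrder }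

module ConvexGeometry (O : TotallyOrderedRing) where
  open TotallyOrderedRing O hiding (zero)
  open IsPartialOrder isPartialOrder using (antisym)
    renaming (refl to ≤-refl; trans to ≤-trans; reflexive to ≤-reflexive)
  open import Algebra.Properties.Semiring.Sum semiring
  open import Algebra.Properties.Ring ring using (-0#≈0#; -‿distribʳ-*; -‿distribˡ-*; -‿+-comm; -‿involutive)
  open import Algebra.Properties.Semiring.Mult semiring using (×-assoc-*; ×-congʳ) renaming (_×_ to _×′_)
  open import Relation.Binary.Reasoning.PartialOrder poset
  open import Algebra.Solver.Ring.NaturalCoefficients.Default commutativeSemiring
    using (solve; _:=_; _:+_; _:*_; con)

  -- Order arithmetic

  x+y-y≈x : ∀ x y → x + y - y ≈ x
  x+y-y≈x x y = begin-equality
    x + y - y    ≈⟨ +-assoc x y (- y) ⟩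
    x + (y - y)  ≈⟨ +-congˡ (-‿inverseʳ y) ⟩
    x + 0#       ≈⟨ +-identityʳ x ⟩
    x            ∎

  x-y+y≈x : ∀ x y → x - y + y ≈ x
  x-y+y≈x x y = begin-equality
    x - y + y      ≈⟨ +-assoc x (- y) y ⟩
    x + (- y + y)  ≈⟨ +-congˡ (-‿inverseˡ y) ⟩
    x + 0#         ≈⟨ +-identityʳ x ⟩
    x              ∎

  +-cancelʳ-≤ : ∀ {x y} z → x + z ≤ y + z → x ≤ y
  +-cancelʳ-≤ {x} {y} z h = begin
    x          ≈⟨ x+y-y≈x x z ⟨
    x + z - z  ≤⟨ +-mono-≤ h ≤-refl ⟩
    y + z - z  ≈⟨ x+y-y≈x y z ⟩
    y          ∎

  +-cancelˡ-≤ : ∀ {x y} z → z + x ≤ z + y → x ≤ y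
  +-cancelˡ-≤ {x} {y} z h = +-cancelʳ-≤ z (begin
    x + z  ≈⟨ +-comm x z ⟩
    z + x  ≤⟨ h ⟩
    z + y  ≈⟨ +-comm z y ⟩
    y + z  ∎)

  neg-antimono-≤ : ∀ {x y} → x ≤ y → - y ≤ - x
  neg-antimono-≤ {x} {y} x≤y = +-cancelʳ-≤ x (begin
    - y + x  ≤⟨ +-mono-≤ ≤-refl x≤y ⟩
    - y + y  ≈⟨ -‿inverseˡ y ⟩
    0#       ≈⟨ -‿inverseˡ x ⟨
    - x + x  ∎)

  neg-cancel-≤ : ∀ {x y} → - y ≤ - x → x ≤ y
  neg-cancel-≤ {x} {y} h = begin
    x      ≈⟨ -‿involutive x ⟨
    - - x  ≤⟨ neg-antimono-≤ h ⟩
    - - y  ≈⟨ -‿involutive y ⟩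
    y      ∎

  total : ∀ x y → x ≤ y ⊎ y ≤ x
  total x y with sign (y - x)
  ... | inj₁ 0≤y-x = inj₁ (begin
    x          ≈⟨ +-identityˡ x ⟨
    0# + x     ≤⟨ +-mono-≤ 0≤y-x ≤-refl ⟩
    y - x + x  ≈⟨ x-y+y≈x y x ⟩
    y          ∎)
  ... | inj₂ y-x≤0 = inj₂ (begin
    y          ≈⟨ x-y+y≈x y x ⟨
    y - x + x  ≤⟨ +-mono-≤ y-x≤0 ≤-refl ⟩
    0# + x     ≈⟨ +-identityˡ x ⟩
    x          ∎)

  0≤1 : 0# ≤ 1#
  0≤1 with sign 1#
  ... | inj₁ 0≤1 = 0≤1
  ... | inj₂ 1≤0 = contradiction 1≤0 1≰0

  x+1≤y⇒x≤y : ∀ {x y} → x + 1# ≤ y → x ≤ y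
  x+1≤y⇒x≤y {x} {y} x+1≤y = begin
    x       ≈⟨ +-identityʳ x ⟨
    x + 0#  ≤⟨ +-mono-≤ ≤-refl 0≤1 ⟩
    x + 1#  ≤⟨ x+1≤y ⟩
    y       ∎

  -- A margin of 1 plays the role of strict inequality throughout; this is its irreflexivity.
  x+1≰x : ∀ {x} → ¬ x + 1# ≤ x
  x+1≰x {x} x+1≤x = 1≰0 (+-cancelˡ-≤ x (≤-trans x+1≤x (≤-reflexive (sym (+-identityʳ x)))))

  *-monoˡ-≤ : ∀ {t x y} → 0# ≤ t → x ≤ y → t * x ≤ t * y
  *-monoˡ-≤ {t} {x} {y} 0≤t x≤y = begin
    t * x                 ≈⟨ +-identityˡ (t * x) ⟨
    0# + t * x            ≤⟨ +-mono-≤ (*-nonneg 0≤t 0≤y-x) ≤-refl ⟩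
    t * (y - x) + t * x   ≈⟨ distribˡ t (y - x) x ⟨
    t * (y - x + x)       ≈⟨ *-congˡ (x-y+y≈x y x) ⟩
    t * y                 ∎
    where
    0≤y-x : 0# ≤ y - x
    0≤y-x = begin
      0#     ≈⟨ -‿inverseʳ x ⟨
      x - x  ≤⟨ +-mono-≤ x≤y ≤-refl ⟩
      y - x  ∎

  *-antimonoˡ-≤ : ∀ {t x y} → t ≤ 0# → x ≤ y → t * y ≤ t * x
  *-antimonoˡ-≤ {t} {x} {y} t≤0 x≤y = neg-cancel-≤ (begin
    - (t * x)  ≈⟨ -‿distribˡ-* t x ⟩
    - t * x    ≤⟨ *-monoˡ-≤ (≤-trans (≤-reflexive (sym -0#≈0#)) (neg-antimono-≤ t≤0)) x≤y ⟩
    - t * y    ≈⟨ -‿distribˡ-* t y ⟨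
    - (t * y)  ∎)

  ×-monoˡ-≤ : ∀ {m n} → m ℕ.≤ n → m ×′ 1# ≤ n ×′ 1#
  ×-monoˡ-≤ {n = zero}  ℕ.z≤n       = ≤-refl
  ×-monoˡ-≤ {n = suc n} ℕ.z≤n       =
    ≤-trans (≤-reflexive (sym (+-identityˡ 0#))) (+-mono-≤ 0≤1 (×-monoˡ-≤ {n = n} ℕ.z≤n))
  ×-monoˡ-≤             (ℕ.s≤s m≤n) = +-mono-≤ ≤-refl (×-monoˡ-≤ m≤n)

  -- Finite sums and the Kronecker delta

  sum-mono-≤ : ∀ {n} {f g : Vector Carrier n} → (∀ i → f i ≤ g i) → sum f ≤ sum g
  sum-mono-≤ {zero}  f≤g = ≤-refl
  sum-mono-≤ {suc n} f≤g = +-mono-≤ (f≤g zero) (sum-mono-≤ (f≤g ∘ suc))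

  -- Equality case of termwise comparison: bounding all terms but one by monotonicity and cancelling
  -- them reverses the inequality of the remaining term.
  sum-tight : ∀ {n} {f g : Vector Carrier n} → (∀ i → f i ≤ g i) → sum g ≤ sum f → ∀ i → g i ≤ f i
  sum-tight {suc n} {f} {g} f≤g Σg≤Σf zero = +-cancelʳ-≤ (sum (g ∘ suc))
    (≤-trans Σg≤Σf (+-mono-≤ ≤-refl (sum-mono-≤ (f≤g ∘ suc))))
  sum-tight {suc n} {f} {g} f≤g Σg≤Σf (suc i) = sum-tight (f≤g ∘ suc) (+-cancelˡ-≤ (g zero)
    (≤-trans Σg≤Σf (+-mono-≤ (f≤g zero) ≤-refl))) i

  -- Every term other than `f j` is at least `x`. The extra `x` on the right makes up for the copy
  -- of `x` standing at position `j`, which avoids writing n - 1 copies.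
  term-lower-bound : ∀ {n} {f : Vector Carrier n} {x} → (∀ i → x ≤ f i) → ∀ j →
    sum (λ (_ : Fin n) → x) + f j ≤ x + sum f
  term-lower-bound {suc n} {f} {x} x≤f zero = begin
    x + sum (λ (_ : Fin n) → x) + f zero
      ≤⟨ +-mono-≤ (+-mono-≤ ≤-refl (sum-mono-≤ (x≤f ∘ suc))) ≤-refl ⟩
    x + sum (f ∘ suc) + f zero
      ≈⟨ solve 3 (λ x s t → x :+ s :+ t := x :+ (t :+ s)) refl x (sum (f ∘ suc)) (f zero) ⟩
    x + sum f                               ∎
  term-lower-bound {suc n} {f} {x} x≤f (suc j) = begin
    x + sum (λ (_ : Fin n) → x) + f (suc j)     ≈⟨ +-assoc x _ (f (suc j)) ⟩
    x + (sum (λ (_ : Fin n) → x) + f (suc j))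
      ≤⟨ +-mono-≤ ≤-refl (≤-trans (term-lower-bound (x≤f ∘ suc) j) (+-mono-≤ (x≤f zero) ≤-refl)) ⟩
    x + sum f                                   ∎

  sum-zero : ∀ {n} {f : Vector Carrier n} → (∀ i → f i ≈ 0#) → sum f ≈ 0#
  sum-zero {n} f≈0 = trans (sum-cong-≋ f≈0) (sum-replicate-zero n)

  sum-neg : ∀ {n} (f : Vector Carrier n) → sum (λ i → - f i) ≈ - sum f
  sum-neg {zero}  f = sym -0#≈0#
  sum-neg {suc n} f = trans (+-congˡ (sum-neg (f ∘ suc))) (-‿+-comm (f zero) (sum (f ∘ suc)))

  sum-const : ∀ n x → sum (λ (_ : Fin n) → x) ≈ (n ×′ 1#) * x
  sum-const n x = begin-equality
    sum (λ (_ : Fin n) → x)   ≈⟨ sum-replicate n ⟩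
    n ×′ x                    ≈⟨ ×-congʳ n (*-identityˡ x) ⟨
    n ×′ (1# * x)             ≈⟨ ×-assoc-* n 1# x ⟨
    (n ×′ 1#) * x             ∎

  -- `δ i` is used both as a standard basis vector and as the convex weight concentrated at `i`.
  δ : ∀ {n} → Fin n → Vector Carrier n
  δ zero    zero    = 1#
  δ zero    (suc j) = 0#
  δ (suc i) zero    = 0#
  δ (suc i) (suc j) = δ i j

  δ-diag : ∀ {n} (i : Fin n) → δ i i ≡ 1#
  δ-diag zero    = ≡.refl
  δ-diag (suc i) = δ-diag i

  δ-off : ∀ {n} {i j : Fin n} → i ≢ j → δ i j ≡ 0#
  δ-off {i = zero}  {zero}  i≢j = contradiction ≡.refl i≢j
  δ-off {i = zero}  {suc j} i≢j = ≡.refl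
  δ-off {i = suc i} {zero}  i≢j = ≡.refl
  δ-off {i = suc i} {suc j} i≢j = δ-off (i≢j ∘ ≡.cong suc)

  δ-comm : ∀ {n} (i j : Fin n) → δ i j ≡ δ j i
  δ-comm zero    zero    = ≡.refl
  δ-comm zero    (suc j) = ≡.refl
  δ-comm (suc i) zero    = ≡.refl
  δ-comm (suc i) (suc j) = δ-comm i j

  0≤δ : ∀ {n} (i j : Fin n) → 0# ≤ δ i j
  0≤δ zero    zero    = 0≤1
  0≤δ zero    (suc j) = ≤-refl
  0≤δ (suc i) zero    = ≤-refl
  0≤δ (suc i) (suc j) = 0≤δ i j

  δ≤1 : ∀ {n} (i j : Fin n) → δ i j ≤ 1#
  δ≤1 zero    zero    = ≤-refl
  δ≤1 zero    (suc j) = 0≤1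
  δ≤1 (suc i) zero    = 0≤1
  δ≤1 (suc i) (suc j) = δ≤1 i j

  -δ≤0 : ∀ {n} (i j : Fin n) → - δ i j ≤ 0#
  -δ≤0 i j = ≤-trans (neg-antimono-≤ (0≤δ i j)) (≤-reflexive -0#≈0#)

  sum-δ* : ∀ {n} (i : Fin n) (f : Vector Carrier n) → sum (λ j → δ i j * f j) ≈ f i
  sum-δ* zero f = begin-equality
    1# * f zero + sum (λ j → 0# * f (suc j))
      ≈⟨ +-cong (*-identityˡ _) (sum-zero (λ j → zeroˡ (f (suc j)))) ⟩
    f zero + 0#                               ≈⟨ +-identityʳ _ ⟩
    f zero                                    ∎
  sum-δ* (suc i) f = begin-equality
    0# * f zero + sum (λ j → δ i j * f (suc j))  ≈⟨ +-cong (zeroˡ _) (sum-δ* i (f ∘ suc)) ⟩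
    0# + f (suc i)                               ≈⟨ +-identityˡ _ ⟩
    f (suc i)                                    ∎

  sum-δ : ∀ {n} (i : Fin n) → sum (δ i) ≈ 1#
  sum-δ i = trans (sum-cong-≋ (λ j → sym (*-identityʳ (δ i j)))) (sum-δ* i (λ _ → 1#))

  sum-single : ∀ {n} (i : Fin n) {f : Vector Carrier n} → (∀ j → j ≢ i → f j ≈ 0#) → sum f ≈ f i
  sum-single i {f} f≈0 = trans (sum-cong-≋ f≈δ*f) (sum-δ* i f)
    where
    f≈δ*f : ∀ j → f j ≈ δ i j * f j
    f≈δ*f j with j Fin.≟ i
    ... | yes ≡.refl = sym (trans (*-congʳ (reflexive (δ-diag j))) (*-identityˡ (f j)))
    ... | no j≢i = begin-equality
      f j          ≈⟨ f≈0 j j≢i ⟩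
      0#           ≈⟨ zeroˡ (f j) ⟨
      0# * f j     ≡⟨ ≡.cong (_* f j) (δ-off (j≢i ∘ ≡.sym)) ⟨
      δ i j * f j  ∎

  argmax : ∀ {n} (f : Vector Carrier (suc n)) → ∃ λ i → ∀ j → f j ≤ f i
  argmax {zero}  f = zero , λ { zero → ≤-refl }
  argmax {suc n} f with i , max ← argmax (f ∘ suc) | total (f (suc i)) (f zero)
  ... | inj₁ fi≤f0 = zero , λ { zero → ≤-refl ; (suc j) → ≤-trans (max j) fi≤f0 }
  ... | inj₂ f0≤fi = suc i , λ { zero → f0≤fi ; (suc j) → max j }

  -- Linear functionals and convex combinations

  Pt : ℕ → Set
  Pt = Vector Carrier

  infix 4 _≐_
  _≐_ : ∀ {d} → Pt d → Pt d → Set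
  p ≐ q = ∀ c → p c ≈ q c

  -- Over the reals this unfolds to `dot`, and `combine` below to `combination`, so the abstract
  -- lemmas apply directly to the definitions of the theorem.
  ⟪_,_⟫ : ∀ {d} → Pt d → Pt d → Carrier
  ⟪ a , y ⟫ = sum λ c → a c * y c

  neg : ∀ {d} → Pt d → Pt d
  neg p c = - p c

  ⟪⟫-comm : ∀ {d} (a y : Pt d) → ⟪ a , y ⟫ ≈ ⟪ y , a ⟫
  ⟪⟫-comm a y = sum-cong-≋ λ c → *-comm (a c) (y c)

  ⟪⟫-congʳ : ∀ {d} (a : Pt d) {y z} → y ≐ z → ⟪ a , y ⟫ ≈ ⟪ a , z ⟫
  ⟪⟫-congʳ a y≐z = sum-cong-≋ λ c → *-congˡ (y≐z c)

  ⟪⟫-+ʳ : ∀ {d} (a y z : Pt d) → ⟪ a , (λ c → y c + z c) ⟫ ≈ ⟪ a , y ⟫ + ⟪ a , z ⟫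
  ⟪⟫-+ʳ a y z = trans (sum-cong-≋ λ c → distribˡ (a c) (y c) (z c))
    (∑-distrib-+ (λ c → a c * y c) (λ c → a c * z c))

  ⟪⟫-*ʳ : ∀ {d} (a : Pt d) t (y : Pt d) → ⟪ a , (λ c → t * y c) ⟫ ≈ t * ⟪ a , y ⟫
  ⟪⟫-*ʳ a t y = trans
    (sum-cong-≋ λ c → solve 3 (λ a t y → a :* (t :* y) := t :* (a :* y)) refl (a c) t (y c))
    (sym (*-distribˡ-sum t (λ c → a c * y c)))

  ⟪⟫-*ˡ : ∀ {d} (a : Pt d) t (y : Pt d) → ⟪ (λ c → t * a c) , y ⟫ ≈ t * ⟪ a , y ⟫
  ⟪⟫-*ˡ a t y = trans (⟪⟫-comm _ y) (trans (⟪⟫-*ʳ y t a) (*-congˡ (⟪⟫-comm y a)))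

  ⟪⟫-negʳ : ∀ {d} (a y : Pt d) → ⟪ a , neg y ⟫ ≈ - ⟪ a , y ⟫
  ⟪⟫-negʳ a y = trans (sum-cong-≋ λ c → sym (-‿distribʳ-* (a c) (y c))) (sum-neg λ c → a c * y c)

  ⟪⟫-negˡ : ∀ {d} (a y : Pt d) → ⟪ neg a , y ⟫ ≈ - ⟪ a , y ⟫
  ⟪⟫-negˡ a y = trans (⟪⟫-comm _ y) (trans (⟪⟫-negʳ y a) (-‿cong (⟪⟫-comm y a)))

  ⟪⟫-δʳ : ∀ {d} (a : Pt d) i → ⟪ a , δ i ⟫ ≈ a i
  ⟪⟫-δʳ a i = trans (⟪⟫-comm a (δ i)) (sum-δ* i a)

  ⟪⟫-zeroʳ : ∀ {d} (a : Pt d) → ⟪ a , (λ _ → 0#) ⟫ ≈ 0#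
  ⟪⟫-zeroʳ a = sum-zero λ c → zeroʳ (a c)

  combine : ∀ {d n} → Vector Carrier n → (Fin n → Pt d) → Pt d
  combine w X c = sum λ i → w i * X i c

  IsConvex : ∀ {n} → Vector Carrier n → Set
  IsConvex w = (∀ i → 0# ≤ w i) × sum w ≈ 1#

  δ-convex : ∀ {n} (i : Fin n) → IsConvex (δ i)
  δ-convex i = 0≤δ i , sum-δ i

  combine-δ : ∀ {d n} (X : Fin n → Pt d) i → X i ≐ combine (δ i) X
  combine-δ X i c = sym (sum-δ* i λ j → X j c)

  ⟪⟫-combine : ∀ {d n} (a : Pt d) w (X : Fin n → Pt d) →
    ⟪ a , combine w X ⟫ ≈ sum λ l → w l * ⟪ a , X l ⟫
  ⟪⟫-combine a w X = begin-equality
    sum (λ c → a c * sum (λ l → w l * X l c))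
      ≈⟨ sum-cong-≋ (λ c → *-distribˡ-sum (a c) (λ l → w l * X l c)) ⟩
    sum (λ c → sum (λ l → a c * (w l * X l c)))  ≈⟨ ∑-comm (λ c l → a c * (w l * X l c)) ⟩
    sum (λ l → sum (λ c → a c * (w l * X l c)))  ≈⟨ sum-cong-≋ (λ l → ⟪⟫-*ʳ a (w l) (X l)) ⟩
    sum (λ l → w l * ⟪ a , X l ⟫)                ∎

  module _ {d n} {X : Fin n → Pt d} {w} (convex : IsConvex w) {y} (y≐ : y ≐ combine w X) (a : Pt d) where

    private
      value : ⟪ a , y ⟫ ≈ sum λ l → w l * ⟪ a , X l ⟫
      value = trans (⟪⟫-congʳ a y≐) (⟪⟫-combine a w X)

      weighted-const : ∀ o → sum (λ l → w l * o) ≈ o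
      weighted-const o = begin-equality
        sum (λ l → w l * o)  ≈⟨ *-distribʳ-sum o w ⟨
        sum w * o            ≈⟨ *-congʳ (proj₂ convex) ⟩
        1# * o               ≈⟨ *-identityˡ o ⟩
        o                    ∎

    convex-≤ : ∀ {o} → (∀ l → ⟪ a , X l ⟫ ≤ o) → ⟪ a , y ⟫ ≤ o
    convex-≤ {o} X≤o = begin
      ⟪ a , y ⟫                      ≈⟨ value ⟩
      sum (λ l → w l * ⟪ a , X l ⟫)  ≤⟨ sum-mono-≤ (λ l → *-monoˡ-≤ (proj₁ convex l) (X≤o l)) ⟩
      sum (λ l → w l * o)            ≈⟨ weighted-const o ⟩
      o                              ∎

    -- When the combination reaches the maximum, each weighted inequality is tight. For `l` other
    -- than `p` the gap of 1 then gives w x + w ≤ w x, where x is the value at `X l`, so the weight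
    -- w vanishes and all weight sits at `p`.
    unique-maximum : ∀ {p} → (∀ l → l ≢ p → ⟪ a , X l ⟫ + 1# ≤ ⟪ a , X p ⟫) →
      ⟪ a , y ⟫ ≈ ⟪ a , X p ⟫ → y ≐ X p
    unique-maximum {p} gap y-max c = begin-equality
      y c                      ≈⟨ y≐ c ⟩
      sum (λ l → w l * X l c)  ≈⟨ sum-single p (λ l l≢p → trans (*-congʳ (w≈0 l l≢p)) (zeroˡ (X l c))) ⟩
      w p * X p c              ≈⟨ *-congʳ (trans (sym (sum-single p w≈0)) (proj₂ convex)) ⟩
      1# * X p c               ≈⟨ *-identityˡ (X p c) ⟩
      X p c                    ∎
      where
      X≤ : ∀ l → ⟪ a , X l ⟫ ≤ ⟪ a , X p ⟫
      X≤ l with l Fin.≟ p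
      ... | yes ≡.refl = ≤-refl
      ... | no l≢p     = x+1≤y⇒x≤y (gap l l≢p)

      tight : ∀ l → w l * ⟪ a , X p ⟫ ≤ w l * ⟪ a , X l ⟫
      tight = sum-tight (λ l → *-monoˡ-≤ (proj₁ convex l) (X≤ l)) (begin
        sum (λ l → w l * ⟪ a , X p ⟫)  ≈⟨ weighted-const _ ⟩
        ⟪ a , X p ⟫                    ≈⟨ y-max ⟨
        ⟪ a , y ⟫                      ≈⟨ value ⟩
        sum (λ l → w l * ⟪ a , X l ⟫)  ∎)

      w≈0 : ∀ l → l ≢ p → w l ≈ 0#
      w≈0 l l≢p = antisym (+-cancelˡ-≤ (w l * ⟪ a , X l ⟫) (begin
        w l * ⟪ a , X l ⟫ + w l
          ≈⟨ solve 2 (λ w x → w :* x :+ w := w :* (x :+ con 1)) refl (w l) ⟪ a , X l ⟫ ⟩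
        w l * (⟪ a , X l ⟫ + 1#)    ≤⟨ *-monoˡ-≤ (proj₁ convex l) (gap l l≢p) ⟩
        w l * ⟪ a , X p ⟫           ≤⟨ tight l ⟩
        w l * ⟪ a , X l ⟫           ≈⟨ +-identityʳ _ ⟨
        w l * ⟪ a , X l ⟫ + 0#      ∎)) (proj₁ convex l)

  -- The largest value on the points dominates the value at any convex combination, so a bound
  -- reached by the combination is reached at a maximising point. The family is nonempty because the
  -- weights add up to 1.
  bound-attained : ∀ {d n} {X : Fin n → Pt d} {w} → IsConvex w → ∀ {y} → y ≐ combine w X → ∀ a {o} →
    (∀ l → ⟪ a , X l ⟫ ≤ o) → ⟪ a , y ⟫ ≈ o → ∃ λ l → ⟪ a , X l ⟫ ≈ o
  bound-attained {n = zero}  (_ , 0≈1) y≐ a X≤o y≈o = contradiction (≤-reflexive (sym 0≈1)) 1≰0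
  bound-attained {n = suc n} {X} convex {y} y≐ a {o} X≤o y≈o with l , max ← argmax (λ l → ⟪ a , X l ⟫) =
    l , antisym (X≤o l) (begin
      o            ≈⟨ y≈o ⟨
      ⟪ a , y ⟫    ≤⟨ convex-≤ convex y≐ a max ⟩
      ⟪ a , X l ⟫  ∎)

  lower-bound-attained : ∀ {d n} {X : Fin n → Pt d} {w} → IsConvex w → ∀ {y} → y ≐ combine w X → ∀ a {o} →
    (∀ l → o ≤ ⟪ a , X l ⟫) → ⟪ a , y ⟫ ≈ o → ∃ λ l → ⟪ a , X l ⟫ ≈ o
  lower-bound-attained {X = X} convex {y} y≐ a {o} o≤X y≈o
    with l , l≈ ← bound-attained convex y≐ (neg a)
      (λ l → ≤-trans (≤-reflexive (⟪⟫-negˡ a (X l))) (neg-antimono-≤ (o≤X l)))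
      (trans (⟪⟫-negˡ a y) (-‿cong y≈o)) = l , (begin-equality
        ⟪ a , X l ⟫          ≈⟨ -‿involutive _ ⟨
        - - ⟪ a , X l ⟫      ≈⟨ -‿cong (⟪⟫-negˡ a (X l)) ⟨
        - ⟪ neg a , X l ⟫    ≈⟨ -‿cong l≈ ⟩
        - - o                ≈⟨ -‿involutive o ⟩
        o                    ∎)

  -- From parallel supporting hyperplanes to one functional

  record Separates {I : Set} {d} (a : Pt d) (X : I → Pt d) (i j : I) : Set where
    field
      lower  : ∀ l → ⟪ a , X i ⟫ ≤ ⟪ a , X l ⟫
      upper  : ∀ l → ⟪ a , X l ⟫ ≤ ⟪ a , X j ⟫
      unique : ∀ l → ⟪ a , X l ⟫ ≈ ⟪ a , X i ⟫ → l ≡ i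

  -- The disjunction in `Supports`, read on the points alone. The side is left open because a normal
  -- is determined only up to a nonzero factor, which may be negative.
  OneSided : ∀ {I : Set} {d} → Pt d → Carrier → (I → Pt d) → Set
  OneSided a o X = (∀ l → ⟪ a , X l ⟫ ≤ o) ⊎ (∀ l → o ≤ ⟪ a , X l ⟫)

  OneSided-neg : ∀ {I : Set} {d} {a : Pt d} {o} {X : I → Pt d} → OneSided a o X → OneSided (neg a) (- o) X
  OneSided-neg {a = a} {o} {X} (inj₁ X≤o) = inj₂ λ l → begin
    - o              ≤⟨ neg-antimono-≤ (X≤o l) ⟩
    - ⟪ a , X l ⟫    ≈⟨ ⟪⟫-negˡ a (X l) ⟨
    ⟪ neg a , X l ⟫  ∎
  OneSided-neg {a = a} {o} {X} (inj₂ o≤X) = inj₁ λ l → begin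
    ⟪ neg a , X l ⟫  ≈⟨ ⟪⟫-negˡ a (X l) ⟩
    - ⟪ a , X l ⟫    ≤⟨ neg-antimono-≤ (o≤X l) ⟩
    - o              ∎

  OneSided-scale : ∀ {I : Set} {d} {a b : Pt d} {q t} {X : I → Pt d} → (∀ c → a c ≈ t * b c) →
    OneSided b q X → OneSided a (t * q) X
  OneSided-scale {a = a} {b} {q} {t} {X} a≈tb side = scale (sign t) side
    where
    value : ∀ l → ⟪ a , X l ⟫ ≈ t * ⟪ b , X l ⟫
    value l = trans (sum-cong-≋ λ c → *-congʳ (a≈tb c)) (⟪⟫-*ˡ b t (X l))

    scale : 0# ≤ t ⊎ t ≤ 0# → OneSided b q X → OneSided a (t * q) X
    scale (inj₁ 0≤t) (inj₁ X≤q) = inj₁ λ l → ≤-trans (≤-reflexive (value l)) (*-monoˡ-≤ 0≤t (X≤q l))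
    scale (inj₁ 0≤t) (inj₂ q≤X) = inj₂ λ l → ≤-trans (*-monoˡ-≤ 0≤t (q≤X l)) (≤-reflexive (sym (value l)))
    scale (inj₂ t≤0) (inj₁ X≤q) = inj₂ λ l → ≤-trans (*-antimonoˡ-≤ t≤0 (X≤q l)) (≤-reflexive (sym (value l)))
    scale (inj₂ t≤0) (inj₂ q≤X) = inj₁ λ l → ≤-trans (≤-reflexive (value l)) (*-antimonoˡ-≤ t≤0 (q≤X l))

  -- The second hyperplane must bound `X` from above: were it a lower bound, `X j` would lie no
  -- higher than `X i`, hence on the first hyperplane, and uniqueness would give `j = i`.
  separate-above : ∀ {I : Set} {d} {a : Pt d} {o o′} {X : I → Pt d} {i j} →
    (∀ l → o ≤ ⟪ a , X l ⟫) → OneSided a o′ X → ⟪ a , X i ⟫ ≈ o → ⟪ a , X j ⟫ ≈ o′ →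
    (∀ l → ⟪ a , X l ⟫ ≈ o → l ≡ i) → i ≢ j → Separates a X i j
  separate-above o≤X (inj₁ X≤o′) i∈ j∈ only _ = record
    { lower  = λ l → ≤-trans (≤-reflexive i∈) (o≤X l)
    ; upper  = λ l → ≤-trans (X≤o′ l) (≤-reflexive (sym j∈))
    ; unique = λ l l≈i → only l (trans l≈i i∈)
    }
  separate-above {i = i} {j} o≤X (inj₂ o′≤X) i∈ j∈ only i≢j = contradiction
    (≡.sym (only j (antisym (≤-trans (≤-reflexive j∈) (≤-trans (o′≤X i) (≤-reflexive i∈))) (o≤X j)))) i≢j

  -- The second hyperplane is rescaled to the normal `a` of the first; if `X` lies below the first
  -- hyperplane, `a` is replaced by its negative, so that `i` ends up at the bottom.
  separate : ∀ {I : Set} {d} {a : Pt d} {o} {b : Pt d} {q t} {X : I → Pt d} {i j} →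
    OneSided a o X → OneSided b q X → (∀ c → a c ≈ t * b c) → ⟪ a , X i ⟫ ≈ o → ⟪ b , X j ⟫ ≈ q →
    (∀ l → ⟪ a , X l ⟫ ≈ o → l ≡ i) → i ≢ j → ∃ λ g → Separates g X i j
  separate {a = a} {o} {b} {q} {t} {X} {i} {j} sideᵃ sideᵇ a≈tb i∈ j∈ only i≢j = orient sideᵃ
    where
    sideᵃ′ : OneSided a (t * q) X
    sideᵃ′ = OneSided-scale a≈tb sideᵇ

    j∈′ : ⟪ a , X j ⟫ ≈ t * q
    j∈′ = begin-equality
      ⟪ a , X j ⟫                    ≈⟨ sum-cong-≋ (λ c → *-congʳ (a≈tb c)) ⟩
      ⟪ (λ c → t * b c) , X j ⟫      ≈⟨ ⟪⟫-*ˡ b t (X j) ⟩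
      t * ⟪ b , X j ⟫                ≈⟨ *-congˡ j∈ ⟩
      t * q                          ∎

    neg-∈ : ∀ {l o} → ⟪ a , X l ⟫ ≈ o → ⟪ neg a , X l ⟫ ≈ - o
    neg-∈ {l} l∈ = trans (⟪⟫-negˡ a (X l)) (-‿cong l∈)

    only-neg : ∀ l → ⟪ neg a , X l ⟫ ≈ - o → l ≡ i
    only-neg l l∈ = only l (begin-equality
      ⟪ a , X l ⟫          ≈⟨ -‿involutive _ ⟨
      - - ⟪ a , X l ⟫      ≈⟨ -‿cong (⟪⟫-negˡ a (X l)) ⟨
      - ⟪ neg a , X l ⟫    ≈⟨ -‿cong l∈ ⟩
      - - o                ≈⟨ -‿involutive o ⟩
      o                    ∎)

    orient : OneSided a o X → ∃ λ g → Separates g X i j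
    orient (inj₂ o≤X) = a , separate-above o≤X sideᵃ′ i∈ j∈′ only i≢j
    orient (inj₁ X≤o) = neg a , separate-above
      (λ l → ≤-trans (neg-antimono-≤ (X≤o l)) (≤-reflexive (sym (⟪⟫-negˡ a (X l)))))
      (OneSided-neg {a = a} {X = X} sideᵃ′) (neg-∈ i∈) (neg-∈ j∈′) only-neg i≢j

  -- Moves from indices in `Fin` to a disjoint sum, where the class of a point is read off its
  -- constructor.
  Separates-split : ∀ {d} {a : Pt d} {m n} {X : Fin m ⊎ Fin n → Pt d} s {j} →
    Separates a (X ∘ splitAt m) (join m n s) j → Separates a X s (splitAt m j)
  Separates-split {a = a} {m} {n} {X} s {j} sep = record
    { lower  = λ t → ≡.subst₂ (λ s t → ⟪ a , X s ⟫ ≤ ⟪ a , X t ⟫) (split s) (split t) (lower (join m n t))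
    ; upper  = λ t → ≡.subst (λ t → ⟪ a , X t ⟫ ≤ ⟪ a , X (splitAt m j) ⟫) (split t) (upper (join m n t))
    ; unique = λ t eq → ≡.trans (≡.sym (split t)) (≡.trans (≡.cong (splitAt m) (unique (join m n t)
                 (≡.subst₂ (λ s t → ⟪ a , X t ⟫ ≈ ⟪ a , X s ⟫) (≡.sym (split s)) (≡.sym (split t)) eq))) (split s))
    }
    where
    open Separates sep
    split : ∀ s → splitAt m (join m n s) ≡ s
    split = Fin.splitAt-join m n

  -- Negation turns the upper bound at `s′` into a bound of the value at `t′` by the minimum, which
  -- is attained at `s` alone.
  Separates-opposite : ∀ {I : Set} {d} {a : Pt d} {X : I → Pt d} {s s′ t t′} →
    X s′ ≐ neg (X s) → X t′ ≐ neg (X t) → Separates a X s t → t′ ≡ s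
  Separates-opposite {a = a} {X} {s} {s′} {t} {t′} s′≐ t′≐ sep = unique t′ (antisym (begin
    ⟪ a , X t′ ⟫      ≈⟨ value t′≐ ⟩
    - ⟪ a , X t ⟫     ≤⟨ neg-antimono-≤ (upper s′) ⟩
    - ⟪ a , X s′ ⟫    ≈⟨ -‿cong (value s′≐) ⟩
    - - ⟪ a , X s ⟫   ≈⟨ -‿involutive _ ⟩
    ⟪ a , X s ⟫       ∎) (lower t′))
    where
    open Separates sep
    value : ∀ {u u′} → X u′ ≐ neg (X u) → ⟪ a , X u′ ⟫ ≈ - ⟪ a , X u ⟫
    value {u} u′≐ = trans (⟪⟫-congʳ a u′≐) (⟪⟫-negʳ a (X u))

  -- Families exposed by explicit functionals

  Exposes : ∀ {I : Set} {d} → (I → Pt d) → (I → Pt d) → Set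
  Exposes u X = ∀ l p → l ≢ p → ⟪ u p , X l ⟫ + 1# ≤ ⟪ u p , X p ⟫

  module _ {I : Set} {d} {u X : I → Pt d} (exposes : Exposes u X) where

    exposed-distinct : ∀ {l p} → l ≢ p → ¬ X l ≐ X p
    exposed-distinct {l} {p} l≢p Xl≐Xp =
      x+1≰x (≤-trans (exposes l p l≢p) (≤-reflexive (sym (⟪⟫-congʳ (u p) Xl≐Xp))))

    exposed-≤ : DecidableEquality I → ∀ p l → ⟪ u p , X l ⟫ ≤ ⟪ u p , X p ⟫
    exposed-≤ _≟_ p l with l ≟ p
    ... | yes ≡.refl = ≤-refl
    ... | no l≢p     = x+1≤y⇒x≤y (exposes l p l≢p)

    -- A zero functional leaves no gap between two points. The second index matters: over a single
    -- point the gap condition is vacuous.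
    exposing≉0 : ∀ {l p} → l ≢ p → ¬ (∀ c → u p c ≈ 0#)
    exposing≉0 {l} {p} l≢p u≈0 =
      x+1≰x (≤-trans (exposes l p l≢p) (≤-reflexive (trans (vanishes p) (sym (vanishes l)))))
      where
      vanishes : ∀ l → ⟪ u p , X l ⟫ ≈ 0#
      vanishes l = sum-zero λ c → trans (*-congʳ (u≈0 c)) (zeroˡ (X l c))

  -- The simplex with points just beyond one facet

  pattern near i = inj₁ i
  pattern apex   = inj₂ zero
  pattern base j = inj₂ (suc j)

  module CappedSimplex {r d} (ι : Fin r → Fin d) (ι-injective : ∀ {i j} → ι i ≡ ι j → i ≡ j) (3≤d : 3 ℕ.≤ d) where

    D : Carrier
    D = d ×′ 1#

    points : Fin r ⊎ Fin (suc d) → Pt d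
    points (near i) c = 1# + δ (ι i) c
    points apex     c = 0#
    points (base j) c = D * δ j c

    -- At a near point its own functional has value D² + D + 2, against D² + D + 1 at other near
    -- points, at most D² + D at base points and 0 at the apex. The functional of a base point
    -- reaches D there, against at most 2 at near points, which is where dimension at least 3
    -- enters. The functional of the apex is negative at every other point.
    normals : Fin r ⊎ Fin (suc d) → Pt d
    normals (near i) c = D + δ (ι i) c
    normals apex     c = - 1#
    normals (base j) c = δ j c

    at-near : ∀ a i → ⟪ a , points (near i) ⟫ ≈ sum a + a (ι i)
    at-near a i = trans (⟪⟫-+ʳ a (λ _ → 1#) (δ (ι i)))
      (+-cong (sum-cong-≋ λ c → *-identityʳ (a c)) (⟪⟫-δʳ a (ι i)))

    at-apex : ∀ a → ⟪ a , points apex ⟫ ≈ 0#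
    at-apex a = ⟪⟫-zeroʳ a

    at-base : ∀ a j → ⟪ a , points (base j) ⟫ ≈ D * a j
    at-base a j = trans (⟪⟫-*ʳ a D (δ j)) (*-congˡ (⟪⟫-δʳ a j))

    3≤D : 1# + 1# + 1# ≤ D
    3≤D = ≤-trans
      (≤-reflexive (solve 0 (con 1 :+ con 1 :+ con 1 := con 1 :+ (con 1 :+ (con 1 :+ con 0))) refl))
      (×-monoˡ-≤ 3≤d)

    1≤D : 1# ≤ D
    1≤D = begin
      1#             ≈⟨ solve 0 (con 0 :+ con 0 :+ con 1 := con 1) refl ⟨
      0# + 0# + 1#   ≤⟨ +-mono-≤ (+-mono-≤ 0≤1 0≤1) ≤-refl ⟩
      1# + 1# + 1#   ≤⟨ 3≤D ⟩
      D              ∎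

    2≤D : 1# + 1# ≤ D
    2≤D = begin
      1# + 1#        ≈⟨ +-congʳ (+-identityˡ 1#) ⟨
      0# + 1# + 1#   ≤⟨ +-mono-≤ (+-mono-≤ 0≤1 ≤-refl) ≤-refl ⟩
      1# + 1# + 1#   ≤⟨ 3≤D ⟩
      D              ∎

    0≤D : 0# ≤ D
    0≤D = ≤-trans 0≤1 1≤D

    sum-normal-near : ∀ i → sum (normals (near i)) ≈ D * D + 1#
    sum-normal-near i = trans (∑-distrib-+ (λ _ → D) (δ (ι i))) (+-cong (sum-const d D) (sum-δ (ι i)))

    exposed-near : ∀ i → ⟪ normals (near i) , points (near i) ⟫ ≈ D * D + 1# + (D + 1#)
    exposed-near i = trans (at-near (normals (near i)) i)
      (+-cong (sum-normal-near i) (+-congˡ (reflexive (δ-diag (ι i)))))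

    exposed-base : ∀ j → ⟪ normals (base j) , points (base j) ⟫ ≈ D
    exposed-base j = trans (at-base (δ j) j) (trans (*-congˡ (reflexive (δ-diag j))) (*-identityʳ D))

    exposes : Exposes normals points
    exposes (near i) (near j) i≢j = begin
      ⟪ normals (near j) , points (near i) ⟫ + 1#  ≈⟨ +-congʳ (at-near (normals (near j)) i) ⟩
      sum (normals (near j)) + (D + δ (ι j) (ι i)) + 1#
        ≈⟨ +-congʳ (+-cong (sum-normal-near j) (+-congˡ (reflexive (δ-off (i≢j ∘ ≡.cong near ∘ ≡.sym ∘ ι-injective))))) ⟩
      D * D + 1# + (D + 0#) + 1#
        ≈⟨ solve 1 (λ D → D :* D :+ con 1 :+ (D :+ con 0) :+ con 1 := D :* D :+ con 1 :+ (D :+ con 1)) refl D ⟩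
      D * D + 1# + (D + 1#)       ≈⟨ exposed-near j ⟨
      ⟪ normals (near j) , points (near j) ⟫ ∎
    exposes apex (near j) _ = begin
      ⟪ normals (near j) , points apex ⟫ + 1#  ≈⟨ +-congʳ (at-apex (normals (near j))) ⟩
      0# + 1#
        ≈⟨ solve 0 (con 0 :+ con 1 := con 0 :+ con 1 :+ (con 0 :+ con 0)) refl ⟩
      0# + 1# + (0# + 0#)
        ≤⟨ +-mono-≤ (+-mono-≤ (*-nonneg 0≤D 0≤D) ≤-refl) (+-mono-≤ 0≤D 0≤1) ⟩
      D * D + 1# + (D + 1#)                    ≈⟨ exposed-near j ⟨
      ⟪ normals (near j) , points (near j) ⟫   ∎
    exposes (base i) (near j) _ = begin
      ⟪ normals (near j) , points (base i) ⟫ + 1#  ≈⟨ +-congʳ (at-base (normals (near j)) i) ⟩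
      D * (D + δ (ι j) i) + 1#
        ≤⟨ +-mono-≤ (*-monoˡ-≤ 0≤D (+-mono-≤ ≤-refl (δ≤1 (ι j) i))) ≤-refl ⟩
      D * (D + 1#) + 1#
        ≈⟨ solve 1 (λ D → D :* (D :+ con 1) :+ con 1 := D :* D :+ con 1 :+ (D :+ con 0)) refl D ⟩
      D * D + 1# + (D + 0#)                        ≤⟨ +-mono-≤ ≤-refl (+-mono-≤ ≤-refl 0≤1) ⟩
      D * D + 1# + (D + 1#)                        ≈⟨ exposed-near j ⟨
      ⟪ normals (near j) , points (near j) ⟫       ∎
    exposes (near i) apex _ = begin
      ⟪ normals apex , points (near i) ⟫ + 1#  ≈⟨ +-congʳ (at-near (normals apex) i) ⟩
      -- The additional unit of the near point in coordinate `ι i` pays for the margin.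
      sum (λ (_ : Fin d) → - 1#) + - 1# + 1#             ≈⟨ x-y+y≈x (sum (λ (_ : Fin d) → - 1#)) 1# ⟩
      sum (λ (_ : Fin d) → - 1#)
        ≤⟨ sum-mono-≤ {d} (λ _ → ≤-trans (neg-antimono-≤ 0≤1) (≤-reflexive -0#≈0#)) ⟩
      sum (λ (_ : Fin d) → 0#)                 ≈⟨ sum-zero {d} (λ _ → refl) ⟩
      0#                                       ≈⟨ at-apex (normals apex) ⟨
      ⟪ normals apex , points apex ⟫           ∎
    exposes apex apex ≢ = contradiction ≡.refl ≢
    exposes (base i) apex _ = begin
      ⟪ normals apex , points (base i) ⟫ + 1#  ≈⟨ +-congʳ (at-base (normals apex) i) ⟩
      D * - 1# + 1#                            ≈⟨ +-congʳ (-‿distribʳ-* D 1#) ⟨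
      - (D * 1#) + 1#                          ≈⟨ +-congʳ (-‿cong (*-identityʳ D)) ⟩
      - D + 1#                                 ≤⟨ +-mono-≤ ≤-refl 1≤D ⟩
      - D + D                                  ≈⟨ -‿inverseˡ D ⟩
      0#                                       ≈⟨ at-apex (normals apex) ⟨
      ⟪ normals apex , points apex ⟫           ∎
    exposes (near i) (base j) _ = begin
      ⟪ normals (base j) , points (near i) ⟫ + 1#  ≈⟨ +-congʳ (at-near (δ j) i) ⟩
      sum (δ j) + δ j (ι i) + 1#
        ≤⟨ +-mono-≤ (+-mono-≤ (≤-reflexive (sum-δ j)) (δ≤1 j (ι i))) ≤-refl ⟩
      1# + 1# + 1#                                 ≤⟨ 3≤D ⟩
      D                                            ≈⟨ exposed-base j ⟨
      ⟪ normals (base j) , points (base j) ⟫       ∎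
    exposes apex (base j) _ = begin
      ⟪ normals (base j) , points apex ⟫ + 1#  ≈⟨ +-congʳ (at-apex (δ j)) ⟩
      0# + 1#                                  ≈⟨ +-identityˡ 1# ⟩
      1#                                       ≤⟨ 1≤D ⟩
      D                                        ≈⟨ exposed-base j ⟨
      ⟪ normals (base j) , points (base j) ⟫   ∎
    exposes (base i) (base j) i≢j = begin
      ⟪ normals (base j) , points (base i) ⟫ + 1#  ≈⟨ +-congʳ (at-base (δ j) i) ⟩
      D * δ j i + 1#
        ≈⟨ +-congʳ (*-congˡ (reflexive (δ-off (i≢j ∘ ≡.cong base ∘ ≡.sym)))) ⟩
      D * 0# + 1#                                  ≈⟨ trans (+-congʳ (zeroʳ D)) (+-identityˡ 1#) ⟩
      1#                                           ≤⟨ 1≤D ⟩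
      D                                            ≈⟨ exposed-base j ⟨
      ⟪ normals (base j) , points (base j) ⟫       ∎

    -- Uses the affine relation D · near i + apex = Σ_c base c + base (ι i).
    near-base-inseparable : ∀ {a i j} → ¬ Separates a points (near i) (base j)
    near-base-inseparable {a} {i} {j} sep =
      base≢near (unique (base (ι i)) (antisym base≤near (lower (base (ι i)))))
      where
      base≢near : ∀ {i : Fin r} {j : Fin d} → base j ≢ near i
      base≢near ()

      open Separates sep
      x : Carrier
      x = sum a + a (ι i)

      x≤ : ∀ c → x ≤ D * a c
      x≤ c = begin
        x                             ≈⟨ at-near a i ⟨
        ⟪ a , points (near i) ⟫       ≤⟨ lower (base c) ⟩
        ⟪ a , points (base c) ⟫       ≈⟨ at-base a c ⟩
        D * a c                       ∎

      0≤top : 0# ≤ D * a j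
      0≤top = begin
        0#                            ≈⟨ at-apex a ⟨
        ⟪ a , points apex ⟫           ≤⟨ upper apex ⟩
        ⟪ a , points (base j) ⟫       ≈⟨ at-base a j ⟩
        D * a j                       ∎

      base≤near : ⟪ a , points (base (ι i)) ⟫ ≤ ⟪ a , points (near i) ⟫
      base≤near = begin
        ⟪ a , points (base (ι i)) ⟫  ≈⟨ at-base a (ι i) ⟩
        -- All base values but the one at `j` are bounded below by the minimum `x`; the one at `j`
        -- is kept, and it is nonnegative because the maximum is no less than the value 0 at the
        -- apex.
        D * a (ι i)                  ≤⟨ +-cancelʳ-≤ (D * sum a) (begin
          D * a (ι i) + D * sum a              ≈⟨ +-identityʳ _ ⟨
          D * a (ι i) + D * sum a + 0#         ≤⟨ +-mono-≤ ≤-refl 0≤top ⟩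
          D * a (ι i) + D * sum a + D * a j
            ≈⟨ +-congʳ (solve 3 (λ D s t → D :* t :+ D :* s := D :* (s :+ t)) refl D (sum a) (a (ι i))) ⟩
          D * x + D * a j                      ≈⟨ +-congʳ (sum-const d x) ⟨
          sum (λ (_ : Fin d) → x) + D * a j    ≤⟨ term-lower-bound x≤ j ⟩
          x + sum (λ c → D * a c)              ≈⟨ +-congˡ (*-distribˡ-sum D a) ⟨
          x + D * sum a                        ∎) ⟩
        x                            ≈⟨ at-near a i ⟨
        ⟪ a , points (near i) ⟫      ∎

    -- The bounds at the base points of the two coordinates add up to `e * D ≤ e` for the increment
    -- `e` from `s` to `t`; with 0 ≤ e and D ≥ 2 this forces e = 0. Writing `t` as `e + s` keeps
    -- subtraction out of the semiring solver.
    near-near-inseparable : ∀ {a i j} → i ≢ j → ¬ Separates a points (near i) (near j)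
    near-near-inseparable {a} {i} {j} i≢j sep =
      i≢j (Sum.inj₁-injective (≡.sym (unique (near j) (antisym near≤near (lower (near j))))))
      where
      open Separates sep
      S s t e : Carrier
      S = sum a
      s = a (ι i)
      t = a (ι j)
      e = t - s

      t≈e+s : t ≈ e + s
      t≈e+s = sym (x-y+y≈x t s)

      0≤e : 0# ≤ e
      0≤e = +-cancelˡ-≤ (S + s) (begin
        S + s + 0#                 ≈⟨ +-identityʳ _ ⟩
        S + s                      ≈⟨ at-near a i ⟨
        ⟪ a , points (near i) ⟫    ≤⟨ lower (near j) ⟩
        ⟪ a , points (near j) ⟫    ≈⟨ at-near a j ⟩
        S + t                      ≈⟨ +-congˡ t≈e+s ⟩
        S + (e + s)                ≈⟨ solve 3 (λ S e s → S :+ (e :+ s) := S :+ s :+ e) refl S e s ⟩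
        S + s + e                  ∎)

      De≤e : e * D ≤ e
      De≤e = +-cancelʳ-≤ (D * s + (S + s)) (begin
        e * D + (D * s + (S + s))
          ≈⟨ solve 4 (λ S e s D → e :* D :+ (D :* s :+ (S :+ s)) := D :* (e :+ s) :+ (S :+ s)) refl S e s D ⟩
        D * (e + s) + (S + s)        ≈⟨ +-congʳ (*-congˡ t≈e+s) ⟨
        D * t + (S + s)              ≤⟨ +-mono-≤ top bottom ⟩
        S + t + D * s                ≈⟨ +-congʳ (+-congˡ t≈e+s) ⟩
        S + (e + s) + D * s
          ≈⟨ solve 4 (λ S e s D → S :+ (e :+ s) :+ D :* s := e :+ (D :* s :+ (S :+ s))) refl S e s D ⟩
        e + (D * s + (S + s))        ∎)
        where
        top : D * t ≤ S + t
        top = begin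
          D * t                          ≈⟨ at-base a (ι j) ⟨
          ⟪ a , points (base (ι j)) ⟫    ≤⟨ upper (base (ι j)) ⟩
          ⟪ a , points (near j) ⟫        ≈⟨ at-near a j ⟩
          S + t                          ∎
        bottom : S + s ≤ D * s
        bottom = begin
          S + s                          ≈⟨ at-near a i ⟨
          ⟪ a , points (near i) ⟫        ≤⟨ lower (base (ι i)) ⟩
          ⟪ a , points (base (ι i)) ⟫    ≈⟨ at-base a (ι i) ⟩
          D * s                          ∎

      e≤0 : e ≤ 0#
      e≤0 = +-cancelˡ-≤ e (begin
        e + e            ≈⟨ solve 1 (λ e → e :+ e := e :* (con 1 :+ con 1)) refl e ⟩
        e * (1# + 1#)    ≤⟨ *-monoˡ-≤ 0≤e 2≤D ⟩
        e * D            ≤⟨ De≤e ⟩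
        e                ≈⟨ +-identityʳ e ⟨
        e + 0#           ∎)

      near≤near : ⟪ a , points (near j) ⟫ ≤ ⟪ a , points (near i) ⟫
      near≤near = begin
        ⟪ a , points (near j) ⟫  ≈⟨ at-near a j ⟩
        S + t                    ≈⟨ +-congˡ t≈e+s ⟩
        S + (e + s)              ≤⟨ +-mono-≤ ≤-refl (+-mono-≤ e≤0 ≤-refl) ⟩
        S + (0# + s)             ≈⟨ +-congˡ (+-identityˡ s) ⟩
        S + s                    ≈⟨ at-near a i ⟨
        ⟪ a , points (near i) ⟫  ∎

    near-partner : ∀ {a i} t → t ≢ near i → Separates a points (near i) t → t ≡ apex
    near-partner (near j) j≢i sep = contradiction sep (near-near-inseparable (j≢i ∘ ≡.cong near ∘ ≡.sym))
    near-partner apex     _   _   = ≡.refl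
    near-partner (base j) _   sep = contradiction sep near-base-inseparable

    -- The apex and the base points already form an affine basis: the base weights are the
    -- coordinates of `y` divided by D, and the apex, being the origin, absorbs what is missing from
    -- total weight 1.
    affinely-spanning : ∀ D⁻¹ → D⁻¹ * D ≈ 1# → ∀ y →
      ∃ λ w → sum w ≈ 1# × y ≐ combine w (points ∘ splitAt r)
    affinely-spanning D⁻¹ inverse y = weight ∘ splitAt r , total-weight , λ c → sym (coordinate c)
      where
      scaled : Pt d
      scaled j = D⁻¹ * y j

      weight : Fin r ⊎ Fin (suc d) → Carrier
      weight (near i) = 0#
      weight apex     = 1# - sum scaled
      weight (base j) = scaled j

      total-weight : sum (weight ∘ splitAt r) ≈ 1#
      total-weight = begin-equality
        sum (weight ∘ splitAt r)                           ≈⟨ sum-splitAt +-monoid r weight ⟩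
        sum (weight ∘ inj₁) + (1# - sum scaled + sum scaled)
          ≈⟨ +-cong (sum-zero {r} (λ _ → refl)) (x-y+y≈x 1# (sum scaled)) ⟩
        0# + 1#                                            ≈⟨ +-identityˡ 1# ⟩
        1#                                                 ∎

      coordinate : ∀ c → combine (weight ∘ splitAt r) (points ∘ splitAt r) c ≈ y c
      coordinate c = begin-equality
        combine (weight ∘ splitAt r) (points ∘ splitAt r) c
          ≈⟨ sum-splitAt +-monoid r (λ s → weight s * points s c) ⟩
        sum (λ i → 0# * (1# + δ (ι i) c)) + ((1# - sum scaled) * 0# + sum (λ j → scaled j * (D * δ j c)))
          ≈⟨ +-cong (sum-zero λ i → zeroˡ (1# + δ (ι i) c)) (+-cong (zeroʳ (1# - sum scaled)) (sum-cong-≋ term)) ⟩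
        0# + (0# + sum (λ j → δ c j * y j))
          ≈⟨ trans (+-identityˡ _) (+-identityˡ _) ⟩
        sum (λ j → δ c j * y j)
          ≈⟨ sum-δ* c y ⟩
        y c ∎
        where
        term : ∀ j → scaled j * (D * δ j c) ≈ δ c j * y j
        term j = begin-equality
          D⁻¹ * y j * (D * δ j c)
            ≈⟨ solve 4 (λ i y D δ → i :* y :* (D :* δ) := i :* D :* (δ :* y)) refl D⁻¹ (y j) D (δ j c) ⟩
          D⁻¹ * D * (δ j c * y j)    ≈⟨ *-congʳ inverse ⟩
          1# * (δ j c * y j)         ≈⟨ *-identityˡ _ ⟩
          δ j c * y j                ≡⟨ ≡.cong (_* y j) (δ-comm j c) ⟩
          δ c j * y j                ∎

  -- The iterated pyramid over a cross-polytope

  pattern plus c  = inj₁ c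
  pattern minus i = inj₂ i

  module Cross (m k : ℕ) where

    points : Fin (m ℕ.+ k) ⊎ Fin k → Pt (m ℕ.+ k)
    points (plus c)  = δ c
    points (minus i) = neg (δ (m ↑ʳ i))

    unit : ∀ s → ⟪ points s , points s ⟫ ≈ 1#
    unit (plus c)  = trans (⟪⟫-δʳ (δ c) c) (reflexive (δ-diag c))
    unit (minus i) = begin-equality
      ⟪ neg e , neg e ⟫    ≈⟨ ⟪⟫-negˡ e (neg e) ⟩
      - ⟪ e , neg e ⟫      ≈⟨ -‿cong (⟪⟫-negʳ e e) ⟩
      - - ⟪ e , e ⟫        ≈⟨ -‿involutive _ ⟩
      ⟪ e , e ⟫            ≈⟨ unit (plus (m ↑ʳ i)) ⟩
      1#                   ∎
      where
      e : Pt (m ℕ.+ k)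
      e = δ (m ↑ʳ i)

    obtuse : ∀ s t → s ≢ t → ⟪ points t , points s ⟫ ≤ 0#
    obtuse (plus c) (plus c′) c≢c′ = ≤-reflexive
      (trans (⟪⟫-δʳ (δ c′) c) (reflexive (δ-off (c≢c′ ∘ ≡.cong plus ∘ ≡.sym))))
    obtuse (plus c) (minus i) _ =
      ≤-trans (≤-reflexive (⟪⟫-δʳ (neg (δ (m ↑ʳ i))) c)) (-δ≤0 (m ↑ʳ i) c)
    obtuse (minus i) (plus c) _ = ≤-trans (≤-reflexive (trans (⟪⟫-negʳ (δ c) (δ (m ↑ʳ i)))
      (-‿cong (⟪⟫-δʳ (δ c) (m ↑ʳ i))))) (-δ≤0 c (m ↑ʳ i))
    obtuse (minus i) (minus i′) i≢i′ = ≤-reflexive (begin-equality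
      ⟪ neg (δ (m ↑ʳ i′)) , neg (δ (m ↑ʳ i)) ⟫  ≈⟨ ⟪⟫-negʳ (neg (δ (m ↑ʳ i′))) (δ (m ↑ʳ i)) ⟩
      - ⟪ neg (δ (m ↑ʳ i′)) , δ (m ↑ʳ i) ⟫      ≈⟨ -‿cong (⟪⟫-δʳ (neg (δ (m ↑ʳ i′))) (m ↑ʳ i)) ⟩
      - - δ (m ↑ʳ i′) (m ↑ʳ i)                  ≈⟨ -‿involutive _ ⟩
      δ (m ↑ʳ i′) (m ↑ʳ i)
        ≡⟨ δ-off (i≢i′ ∘ ≡.cong minus ∘ ≡.sym ∘ Fin.↑ʳ-injective m i′ i) ⟩
      0#                                        ∎)

    -- Each point is its own normal: the points are unit vectors with pairwise nonpositive inner
    -- products.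
    exposes : Exposes points points
    exposes s t s≢t = begin
      ⟪ points t , points s ⟫ + 1#  ≤⟨ +-mono-≤ (obtuse s t s≢t) ≤-refl ⟩
      0# + 1#                       ≈⟨ +-identityˡ 1# ⟩
      1#                            ≈⟨ unit t ⟨
      ⟪ points t , points t ⟫       ∎

    -- `Fin k ⊎ Fin k` names the 2k points whose negatives are also points; `antipode` locates the
    -- negative of the point that `symmetric` locates.
    antipode : Fin k ⊎ Fin k → Fin (m ℕ.+ k) ⊎ Fin k
    antipode (inj₁ i) = minus i
    antipode (inj₂ i) = plus (m ↑ʳ i)

    symmetric : Fin k ⊎ Fin k → Fin (m ℕ.+ k) ⊎ Fin k
    symmetric (inj₁ i) = plus (m ↑ʳ i)
    symmetric (inj₂ i) = minus i

    antipode-neg : ∀ s → points (antipode s) ≐ neg (points (symmetric s))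
    antipode-neg (inj₁ i) c = refl
    antipode-neg (inj₂ i) c = sym (-‿involutive _)

    separated-antipodes : ∀ {a} s t → Separates a points (symmetric s) (symmetric t) → antipode t ≡ symmetric s
    separated-antipodes s t = Separates-opposite {s = symmetric s} {antipode s} {symmetric t} {antipode t}
      (antipode-neg s) (antipode-neg t)

    -- If `t` were a minus point, its antipode would be a plus point, yet that antipode has to be
    -- `minus i`.
    minus-partner : ∀ {a i} t → Separates a points (minus i) t → ∃ λ c → t ≡ plus c
    minus-partner         (plus c)  _   = c , ≡.refl
    minus-partner {i = i} (minus j) sep with () ← separated-antipodes (inj₂ i) (inj₂ j) sep

    -- Among the symmetric points only the antipode survives; what remains are the first `m` basis
    -- vectors, which have no antipode in the family.
    plus-partner : ∀ {a i} t → Separates a points (plus (m ↑ʳ i)) t →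
      t ≡ minus i ⊎ ∃ λ e → t ≡ plus (e ↑ˡ k)
    plus-partner {i = i} (minus j) sep = inj₁ (≡.cong minus
      (Fin.↑ʳ-injective m j i (Sum.inj₁-injective (separated-antipodes (inj₁ i) (inj₂ j) sep))))
    plus-partner {i = i} (plus c) sep with splitAt m c in eq
    ... | inj₁ e = inj₂ (e , ≡.cong plus (≡.sym (Fin.splitAt⁻¹-↑ˡ eq)))
    ... | inj₂ j with () ← separated-antipodes (inj₁ i) (inj₁ j)
                       (≡.subst (Separates _ points (plus (m ↑ʳ i)) ∘ plus) (≡.sym (Fin.splitAt⁻¹-↑ʳ eq)) sep)

    -- The coordinates of `y` as weights on the basis vectors give the right point with total weight
    -- `sum y`. Half of the defect 1 - sum y is added to each point of one antipodal pair, which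
    -- corrects the total without moving the point.
    affinely-spanning : ∀ ½ → ½ + ½ ≈ 1# → Fin k → ∀ y →
      ∃ λ w → sum w ≈ 1# × y ≐ combine w (points ∘ splitAt (m ℕ.+ k))
    affinely-spanning ½ halves i₀ y = weight ∘ splitAt (m ℕ.+ k) , total-weight , λ c → sym (coordinate c)
      where
      c₀ : Fin (m ℕ.+ k)
      c₀ = m ↑ʳ i₀

      t : Carrier
      t = ½ * (1# - sum y)

      weight : Fin (m ℕ.+ k) ⊎ Fin k → Carrier
      weight (plus c)  = y c + δ c₀ c * t
      weight (minus i) = δ i₀ i * t

      total-weight : sum (weight ∘ splitAt (m ℕ.+ k)) ≈ 1#
      total-weight = begin-equality
        sum (weight ∘ splitAt (m ℕ.+ k))
          ≈⟨ sum-splitAt +-monoid (m ℕ.+ k) weight ⟩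
        sum (λ c → y c + δ c₀ c * t) + sum (λ i → δ i₀ i * t)
          ≈⟨ +-cong (trans (∑-distrib-+ y (λ c → δ c₀ c * t)) (+-congˡ (sum-δ* c₀ (λ _ → t)))) (sum-δ* i₀ (λ _ → t)) ⟩
        sum y + t + t
          ≈⟨ solve 3 (λ s h x → s :+ h :* x :+ h :* x := (h :+ h) :* x :+ s) refl (sum y) ½ (1# - sum y) ⟩
        (½ + ½) * (1# - sum y) + sum y
          ≈⟨ +-congʳ (trans (*-congʳ halves) (*-identityˡ _)) ⟩
        1# - sum y + sum y
          ≈⟨ x-y+y≈x 1# (sum y) ⟩
        1# ∎

      coordinate : ∀ c → combine (weight ∘ splitAt (m ℕ.+ k)) (points ∘ splitAt (m ℕ.+ k)) c ≈ y c
      coordinate c = begin-equality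
        combine (weight ∘ splitAt (m ℕ.+ k)) (points ∘ splitAt (m ℕ.+ k)) c
          ≈⟨ sum-splitAt +-monoid (m ℕ.+ k) (λ s → weight s * points s c) ⟩
        sum (λ c′ → (y c′ + δ c₀ c′ * t) * δ c′ c) + sum (λ i → δ i₀ i * t * - δ (m ↑ʳ i) c)
          ≈⟨ +-cong (sum-cong-≋ λ c′ → trans (*-comm _ _) (*-congʳ (reflexive (δ-comm c′ c))))
                    (sum-cong-≋ λ i → *-assoc (δ i₀ i) t (- δ (m ↑ʳ i) c)) ⟩
        sum (λ c′ → δ c c′ * (y c′ + δ c₀ c′ * t)) + sum (λ i → δ i₀ i * (t * - δ (m ↑ʳ i) c))
          ≈⟨ +-cong (sum-δ* c (λ c′ → y c′ + δ c₀ c′ * t)) (sum-δ* i₀ (λ i → t * - δ (m ↑ʳ i) c)) ⟩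
        y c + δ c₀ c * t + t * - δ c₀ c
          ≈⟨ +-cong (+-congˡ (*-comm (δ c₀ c) t)) (sym (-‿distribʳ-* t (δ c₀ c))) ⟩
        y c + t * δ c₀ c - t * δ c₀ c
          ≈⟨ x+y-y≈x (y c) (t * δ c₀ c) ⟩
        y c ∎

-- Counting pairs

open ≡ using (refl; sym; trans; cong; cong₂; subst)


module _ {A : Set} {P : A → Set} (P? : Decidable P) where

  -- The bound for a row of the pair count about which only the order is known: partners of `i` come
  -- after `i`.
  filter-tail-≤ : ∀ {n} (f : Fin n → A) {i : Fin n} → (∀ j → P (f j) → i Fin.< j) →
    length (filter P? (tabulate f)) ℕ.≤ n ∸ suc (toℕ i)
  filter-tail-≤ {suc n} f {i} after
    -- No index is below 0, so the head is always rejected; once `i` is 0 the length of the tail is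
    -- the bound.
    rewrite List.filter-reject P? {xs = tabulate (f ∘ suc)} (λ Pf0 → ℕ.n≮0 (after zero Pf0)) with i
  ... | zero  = ℕ.≤-trans (List.length-filter P? (tabulate (f ∘ suc)))
                  (ℕ.≤-reflexive (List.length-tabulate (f ∘ suc)))
  ... | suc i = filter-tail-≤ (f ∘ suc) λ j Pfj → ℕ.s<s⁻¹ (after (suc j) Pfj)

  filter-none-≤ : ∀ {n} (f : Fin n → A) → (∀ j → ¬ P (f j)) → length (filter P? (tabulate f)) ℕ.≤ 0
  filter-none-≤ f none = ℕ.≤-reflexive (cong length (List.filter-none P? (All.tabulate⁺ none)))

  filter-single-≤ : ∀ {n} (f : Fin n → A) i → (∀ j → P (f j) → j ≡ i) →
    length (filter P? (tabulate f)) ℕ.≤ 1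
  filter-single-≤ {suc n} f zero only
    with rest ← filter-none-≤ (f ∘ suc) (λ j Pfj → Fin.0≢1+n (sym (only (suc j) Pfj))) | does (P? (f zero))
  ... | true  = s≤s rest
  ... | false = ℕ.m≤n⇒m≤1+n rest
  filter-single-≤ {suc n} f (suc i) only
    rewrite List.filter-reject P? {xs = tabulate (f ∘ suc)} (λ Pf0 → Fin.0≢1+n (only zero Pf0)) =
    filter-single-≤ (f ∘ suc) i λ j Pfj → Fin.suc-injective (only (suc j) Pfj)

  length-filter-map : ∀ {B : Set} (f : B → A) xs → length (filter P? (map f xs)) ≡ length (filter (P? ∘ f) xs)
  length-filter-map f []       = refl
  length-filter-map f (x ∷ xs) with ih ← length-filter-map f xs | does (P? (f x))
  ... | true  = cong suc ih
  ... | false = ih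

filter-product-≤ : ∀ {A B : Set} {Q : A × B → Set} (Q? : Decidable Q) ys (b : A → ℕ) →
  (∀ x → length (filter (Q? ∘ (x ,_)) ys) ℕ.≤ b x) → ∀ {n} (f : Fin n → A) →
  length (filter Q? (cartesianProduct (tabulate f) ys)) ℕ.≤ sumℕ (b ∘ f)
filter-product-≤ Q? ys b rows {zero}  f = z≤n
filter-product-≤ Q? ys b rows {suc n} f = begin
  length (filter Q? (row ++ rest))                    ≡⟨ cong length (List.filter-++ Q? row rest) ⟩
  length (filter Q? row ++ filter Q? rest)            ≡⟨ List.length-++ (filter Q? row) ⟩
  length (filter Q? row) ℕ.+ length (filter Q? rest)
    ≡⟨ cong (ℕ._+ length (filter Q? rest)) (length-filter-map Q? (f zero ,_) ys) ⟩
  length (filter (Q? ∘ (f zero ,_)) ys) ℕ.+ length (filter Q? rest)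
    ≤⟨ ℕ.+-mono-≤ (rows (f zero)) (filter-product-≤ Q? ys b rows (f ∘ suc)) ⟩
  b (f zero) ℕ.+ sumℕ (b ∘ f ∘ suc)                          ∎
  where
  open ℕ.≤-Reasoning
  row rest : List _
  row  = map (f zero ,_) ys
  rest = cartesianProduct (tabulate (f ∘ suc)) ys

-- Pairs are counted in the row of their first entry, and the rows are indexed by the disjoint sum
-- so that each block of points can have its own bound.
pairs-≤ : ∀ m {n} {Q : Fin (m ℕ.+ n) × Fin (m ℕ.+ n) → Set} (Q? : Decidable Q) (b : Fin m ⊎ Fin n → ℕ) →
  (∀ s → length (filter (Q? ∘ (join m n s ,_)) (allFin (m ℕ.+ n))) ℕ.≤ b s) →
  length (filter Q? (cartesianProduct (allFin (m ℕ.+ n)) (allFin (m ℕ.+ n))))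
    ℕ.≤ sumℕ (b ∘ inj₁) ℕ.+ sumℕ (b ∘ inj₂)
pairs-≤ m {n} Q? b rows = ℕ.≤-trans
  (filter-product-≤ Q? (allFin (m ℕ.+ n)) (b ∘ splitAt m)
    (λ i → subst (λ i′ → length (filter (Q? ∘ (i′ ,_)) (allFin (m ℕ.+ n))) ℕ.≤ b (splitAt m i))
      (Fin.join-splitAt m n i) (rows (splitAt m i))) id)
  (ℕ.≤-reflexive (sum-splitAt ℕ.+-0-monoid m b))

sumℕ-const : ∀ n x → sumℕ {n} (λ _ → x) ≡ n ℕ.* x
sumℕ-const zero    x = refl
sumℕ-const (suc n) x = cong (x ℕ.+_) (sumℕ-const n x)

-- The number of pairs i < j < m + c with i < m.
staircase : ℕ → ℕ → ℕ
staircase m c = sumℕ {m} λ e → (m ℕ.+ c) ∸ suc (toℕ e)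

-- A pair among m + c points either has its smaller index among the first m or lies within the last
-- c.
staircase-split : ∀ m c → staircase (m ℕ.+ c) 0 ≡ staircase m c ℕ.+ staircase c 0
staircase-split zero    c = refl
staircase-split (suc m) c = begin
  m ℕ.+ c ℕ.+ 0 ℕ.+ staircase (m ℕ.+ c) 0
    ≡⟨ cong₂ ℕ._+_ (ℕ.+-identityʳ (m ℕ.+ c)) (staircase-split m c) ⟩
  m ℕ.+ c ℕ.+ (staircase m c ℕ.+ staircase c 0)
    ≡⟨ ℕ.+-assoc (m ℕ.+ c) (staircase m c) (staircase c 0) ⟨
  m ℕ.+ c ℕ.+ staircase m c ℕ.+ staircase c 0       ∎
  where open ≡.≡-Reasoning

-- Adding `m` on the left replaces the truncated subtraction in m (m + 2c - 1) and makes the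
-- induction purely polynomial.
staircase-double : ∀ m c → staircase m c ℕ.* 2 ℕ.+ m ≡ m ℕ.* (m ℕ.+ 2 ℕ.* c)
staircase-double zero    c = refl
staircase-double (suc m) c = begin
  (m ℕ.+ c ℕ.+ staircase m c) ℕ.* 2 ℕ.+ suc m
    ≡⟨ solve 3 (λ m c s → (m :+ c :+ s) :* con 2 :+ (con 1 :+ m) := con 1 :+ con 2 :* (m :+ c) :+ (s :* con 2 :+ m)) refl m c (staircase m c) ⟩
  1 ℕ.+ 2 ℕ.* (m ℕ.+ c) ℕ.+ (staircase m c ℕ.* 2 ℕ.+ m)
    ≡⟨ cong (1 ℕ.+ 2 ℕ.* (m ℕ.+ c) ℕ.+_) (staircase-double m c) ⟩
  1 ℕ.+ 2 ℕ.* (m ℕ.+ c) ℕ.+ m ℕ.* (m ℕ.+ 2 ℕ.* c)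
    ≡⟨ solve 2 (λ m c → con 1 :+ con 2 :* (m :+ c) :+ m :* (m :+ con 2 :* c) := (con 1 :+ m) :* (con 1 :+ m :+ con 2 :* c)) refl m c ⟩
  suc m ℕ.* (suc m ℕ.+ 2 ℕ.* c) ∎
  where
  open ≡.≡-Reasoning
  open ℕ-Solver

staircase*2 : ∀ m c → staircase m c ℕ.* 2 ≡ m ℕ.* (m ℕ.+ 2 ℕ.* c ∸ 1)
staircase*2 zero    c = refl
staircase*2 (suc m) c = ℕ.+-cancelʳ-≡ (suc m) _ _ (trans (staircase-double (suc m) c)
  (trans (ℕ.*-suc (suc m) (m ℕ.+ 2 ℕ.* c)) (ℕ.+-comm (suc m) _)))

staircase-closed : ∀ m c → m ℕ.* (m ℕ.+ 2 ℕ.* c ∸ 1) / 2 ≡ staircase m c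
staircase-closed m c = trans (cong (_/ 2) (sym (staircase*2 m c))) (m*n/n≡m (staircase m c) 2)

triangle : ∀ n → n ℕ.* (n ∸ 1) / 2 ≡ staircase n 0
triangle n = trans (cong (λ x → n ℕ.* (x ∸ 1) / 2) (sym (ℕ.+-identityʳ n))) (staircase-closed n 0)

↑ˡ-<-↑ʳ : ∀ {a b} (i : Fin a) (j : Fin b) → toℕ i ℕ.< toℕ (a ↑ʳ j)
↑ˡ-<-↑ʳ {a} i j = subst (toℕ i ℕ.<_) (sym (Fin.toℕ-↑ʳ a j))
  (ℕ.<-≤-trans (Fin.toℕ<n i) (ℕ.m≤m+n a (toℕ j)))

-- The reals as a totally ordered ring

open import Defs
open import Algebra.Definitions.RawMonoid +-rawMonoid using () renaming (_×_ to _×′_)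

Eventually : (ℕ → Set) → Set
Eventually P = ∃ λ N → ∀ n → N ℕ.≤ n → P n

eventually-map : ∀ {P Q} → (∀ n → P n → Q n) → Eventually P → Eventually Q
eventually-map f (N , h) = N , λ n n≥ → f n (h n n≥)

eventually-zip : ∀ {P Q R} → (∀ n → P n → Q n → R n) → Eventually P → Eventually Q → Eventually R
eventually-zip f (M , g) (N , h) = M ℕ.⊔ N , λ n n≥ →
  f n (g n (ℕ.m⊔n≤o⇒m≤o M N n≥)) (h n (ℕ.m⊔n≤o⇒n≤o M N n≥))

-- `x ≈ y` unfolds to nullity of the difference of the sequences, so each congruence follows from a
-- ring identity and closure properties of null sequences.
Null : (ℕ → ℚ) → Set
Null s = ∀ ε → 0ℚ ℚ.< ε → Eventually λ n → ∣ s n ∣ ℚ.< ε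

Bounded : (ℕ → ℚ) → Set
Bounded s = ∃ λ B → 0ℚ ℚ.< B × Eventually λ n → ∣ s n ∣ ℚ.≤ B

module _ where
  open ℚ.≤-Reasoning
  open ℚ-Solver

  half-positive : ∀ {ε} → 0ℚ ℚ.< ε → 0ℚ ℚ.< ½ ℚ.* ε
  half-positive {ε} 0<ε = ℚ.positive⁻¹ (½ ℚ.* ε) {{ℚ.pos*pos⇒pos ½ ε {{ℚ.positive 0<ε}}}}

  half+half : ∀ ε → ½ ℚ.* ε ℚ.+ ½ ℚ.* ε ≡ ε
  half+half = solve 1 (λ ε → con ½ :* ε :+ con ½ :* ε := ε) refl

  small-product : ∀ {ε B} → 0ℚ ℚ.< ε → 0ℚ ℚ.< B →
    ∃ λ δ → 0ℚ ℚ.< δ × ∀ p q → ∣ p ∣ ℚ.≤ B → ∣ q ∣ ℚ.< δ → ∣ p ℚ.* q ∣ ℚ.< ε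
  small-product {ε} {B} 0<ε 0<B = δ , ℚ.positive⁻¹ δ {{ℚ.pos*pos⇒pos (ℚ.1/ B) ε}} , λ p q p≤B q<δ → begin-strict
      ∣ p ℚ.* q ∣             ≡⟨ ℚ.∣p*q∣≡∣p∣*∣q∣ p q ⟩
      ∣ p ∣ ℚ.* ∣ q ∣         ≤⟨ ℚ.*-monoʳ-≤-nonNeg ∣ q ∣ {{ℚ.∣-∣-nonNeg q}} p≤B ⟩
      B ℚ.* ∣ q ∣             <⟨ ℚ.*-monoʳ-<-pos B q<δ ⟩
      B ℚ.* (ℚ.1/ B ℚ.* ε)    ≡⟨ ℚ.*-assoc B (ℚ.1/ B) ε ⟨
      B ℚ.* ℚ.1/ B ℚ.* ε      ≡⟨ cong (ℚ._* ε) (ℚ.*-inverseʳ B) ⟩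
      1ℚ ℚ.* ε                ≡⟨ ℚ.*-identityˡ ε ⟩
      ε                       ∎
    where
    instance
      B-positive : ℚ.Positive B
      B-positive = ℚ.positive 0<B
      ε-positive : ℚ.Positive ε
      ε-positive = ℚ.positive 0<ε
      B-nonZero : ℚ.NonZero B
      B-nonZero = ℚ.pos⇒nonZero B
      1/B-positive : ℚ.Positive (ℚ.1/ B)
      1/B-positive = ℚ.1/pos⇒pos B
    δ : ℚ
    δ = ℚ.1/ B ℚ.* ε

  p≤∣p∣ : ∀ p → p ℚ.≤ ∣ p ∣
  p≤∣p∣ p with ℚ.≤-total 0ℚ p
  ... | inj₁ 0≤p = ℚ.≤-reflexive (sym (ℚ.0≤p⇒∣p∣≡p 0≤p))
  ... | inj₂ p≤0 = ℚ.≤-trans p≤0 (ℚ.0≤∣p∣ p)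

  ∣p∣<ε⇒-ε<p : ∀ {p ε} → ∣ p ∣ ℚ.< ε → 0ℚ ℚ.< p ℚ.+ ε
  ∣p∣<ε⇒-ε<p {p} {ε} p<ε = begin-strict
    0ℚ              ≡⟨ ℚ.+-inverseʳ p ⟨
    p ℚ.+ (ℚ.- p)   ≤⟨ ℚ.+-monoʳ-≤ p (p≤∣p∣ (ℚ.- p)) ⟩
    p ℚ.+ ∣ ℚ.- p ∣ ≡⟨ cong (p ℚ.+_) (ℚ.∣-p∣≡∣p∣ p) ⟩
    p ℚ.+ ∣ p ∣     <⟨ ℚ.+-monoʳ-< p p<ε ⟩
    p ℚ.+ ε         ∎

  ∣p-q∣<ε⇒p<q+ε : ∀ p q {ε} → ∣ p ℚ.- q ∣ ℚ.< ε → p ℚ.< q ℚ.+ ε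
  ∣p-q∣<ε⇒p<q+ε p q {ε} h = begin-strict
    p                 ≡⟨ solve 2 (λ p q → p := q :+ (p :- q)) refl p q ⟩
    q ℚ.+ (p ℚ.- q)   ≤⟨ ℚ.+-monoʳ-≤ q (p≤∣p∣ (p ℚ.- q)) ⟩
    q ℚ.+ ∣ p ℚ.- q ∣ <⟨ ℚ.+-monoʳ-< q h ⟩
    q ℚ.+ ε           ∎

  p<q+ε⇒p-q<ε : ∀ p q {ε} → p ℚ.< q ℚ.+ ε → p ℚ.- q ℚ.< ε
  p<q+ε⇒p-q<ε p q {ε} h = begin-strict
    p ℚ.- q           <⟨ ℚ.+-monoˡ-< (ℚ.- q) h ⟩
    q ℚ.+ ε ℚ.- q     ≡⟨ solve 2 (λ q ε → q :+ ε :- q := ε) refl q ε ⟩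
    ε                 ∎

  between⇒∣p-q∣<ε : ∀ p q {ε} → p ℚ.< q ℚ.+ ε → q ℚ.< p ℚ.+ ε → ∣ p ℚ.- q ∣ ℚ.< ε
  between⇒∣p-q∣<ε p q {ε} p<q+ε q<p+ε with ℚ.∣p∣≡p∨∣p∣≡-p (p ℚ.- q)
  ... | inj₁ eq = subst (ℚ._< ε) (sym eq) (p<q+ε⇒p-q<ε p q p<q+ε)
  ... | inj₂ eq = subst (ℚ._< ε)
    (trans (solve 2 (λ p q → q :- p := :- (p :- q)) refl p q) (sym eq)) (p<q+ε⇒p-q<ε q p q<p+ε)

  null-cong : ∀ {s t} → (∀ n → s n ≡ t n) → Null s → Null t
  null-cong s≡t s-null ε 0<ε =
    eventually-map (λ n → subst (λ q → ∣ q ∣ ℚ.< ε) (s≡t n)) (s-null ε 0<ε)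

  null-neg : ∀ {s} → Null s → Null (λ n → ℚ.- s n)
  null-neg {s} s-null ε 0<ε =
    eventually-map (λ n → subst (ℚ._< ε) (sym (ℚ.∣-p∣≡∣p∣ (s n)))) (s-null ε 0<ε)

  null-+ : ∀ {s t} → Null s → Null t → Null (λ n → s n ℚ.+ t n)
  null-+ {s} {t} s-null t-null ε 0<ε = eventually-zip
    (λ n sn<ε tn<ε → begin-strict
      ∣ s n ℚ.+ t n ∣        ≤⟨ ℚ.∣p+q∣≤∣p∣+∣q∣ (s n) (t n) ⟩
      ∣ s n ∣ ℚ.+ ∣ t n ∣    <⟨ ℚ.+-mono-< sn<ε tn<ε ⟩
      ½ ℚ.* ε ℚ.+ ½ ℚ.* ε   ≡⟨ half+half ε ⟩
      ε                     ∎)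
    (s-null _ (half-positive 0<ε)) (t-null _ (half-positive 0<ε))

  bounded*null : ∀ {s t} → Bounded s → Null t → Null (λ n → s n ℚ.* t n)
  bounded*null {s} {t} (B , 0<B , s≤B) t-null ε 0<ε with δ , 0<δ , h ← small-product 0<ε 0<B =
    eventually-zip (λ n → h (s n) (t n)) s≤B (t-null δ 0<δ)

  seq-bounded : ∀ x → Bounded (seq x)
  seq-bounded x with N , h ← cauchy x 1ℚ (ℚ.positive⁻¹ 1ℚ) =
    1ℚ ℚ.+ ∣ seq x N ∣ , ℚ.+-mono-<-≤ (ℚ.positive⁻¹ 1ℚ) (ℚ.0≤∣p∣ (seq x N)) , N , λ n n≥ → begin
      ∣ seq x n ∣
        ≡⟨ cong ∣_∣ (solve 2 (λ a b → a := (a :- b) :+ b) refl (seq x n) (seq x N)) ⟩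
      ∣ (seq x n ℚ.- seq x N) ℚ.+ seq x N ∣
        ≤⟨ ℚ.∣p+q∣≤∣p∣+∣q∣ (seq x n ℚ.- seq x N) (seq x N) ⟩
      ∣ seq x n ℚ.- seq x N ∣ ℚ.+ ∣ seq x N ∣
        ≤⟨ ℚ.+-monoˡ-≤ ∣ seq x N ∣ (ℚ.<⇒≤ (h n N n≥ ℕ.≤-refl)) ⟩
      1ℚ ℚ.+ ∣ seq x N ∣
        ∎

  -- Reduces the ring laws to laws of rationals. The reals are explicit here and below because `_≈_`
  -- unfolds to a statement about sequences, from which the Cauchy proofs cannot be inferred.
  pointwise : ∀ x y → (∀ n → seq x n ≡ seq y n) → x ≈ y
  pointwise x y x≡y ε 0<ε = 0 , λ n _ → subst (ℚ._< ε)
    (cong ∣_∣ (trans (sym (ℚ.+-inverseʳ (seq y n))) (cong (ℚ._- seq y n) (sym (x≡y n))))) 0<ε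

  ≈-refl : ∀ x → x ≈ x
  ≈-refl x = pointwise x x λ _ → refl

  ≈-sym : ∀ x y → x ≈ y → y ≈ x
  ≈-sym x y x≈y = null-cong
    (λ n → solve 2 (λ a b → :- (a :- b) := b :- a) refl (seq x n) (seq y n)) (null-neg x≈y)

  ≈-trans : ∀ x y z → x ≈ y → y ≈ z → x ≈ z
  ≈-trans x y z x≈y y≈z = null-cong
    (λ n → solve 3 (λ a b c → (a :- b) :+ (b :- c) := a :- c) refl (seq x n) (seq y n) (seq z n))
    (null-+ x≈y y≈z)

  infix 8 -_
  -_ : ℝ → ℝ
  seq    (- x) n = ℚ.- seq x n
  cauchy (- x) ε 0<ε with N , h ← cauchy x ε 0<ε = N , λ m n m≥ n≥ → begin-strict
    ∣ ℚ.- seq x m ℚ.- ℚ.- seq x n ∣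
      ≡⟨ cong ∣_∣ (solve 2 (λ a b → :- a :- (:- b) := :- (a :- b)) refl (seq x m) (seq x n)) ⟩
    ∣ ℚ.- (seq x m ℚ.- seq x n) ∣
      ≡⟨ ℚ.∣-p∣≡∣p∣ (seq x m ℚ.- seq x n) ⟩
    ∣ seq x m ℚ.- seq x n ∣
      <⟨ h m n m≥ n≥ ⟩
    ε ∎

  +-cong : ∀ x x′ y y′ → x ≈ x′ → y ≈ y′ → x + y ≈ x′ + y′
  +-cong x x′ y y′ x≈x′ y≈y′ = null-cong
    (λ n → solve 4 (λ a a′ b b′ → (a :- a′) :+ (b :- b′) := (a :+ b) :- (a′ :+ b′)) refl
             (seq x n) (seq x′ n) (seq y n) (seq y′ n))
    (null-+ x≈x′ y≈y′)

  *-cong : ∀ x x′ y y′ → x ≈ x′ → y ≈ y′ → x * y ≈ x′ * y′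
  *-cong x x′ y y′ x≈x′ y≈y′ = null-cong
    (λ n → solve 4 (λ a a′ b b′ → a :* (b :- b′) :+ b′ :* (a :- a′) := a :* b :- a′ :* b′) refl
             (seq x n) (seq x′ n) (seq y n) (seq y′ n))
    (null-+ (bounded*null (seq-bounded x) y≈y′) (bounded*null (seq-bounded y′) x≈x′))

  -‿cong : ∀ x y → x ≈ y → - x ≈ - y
  -‿cong x y x≈y = null-cong
    (λ n → solve 2 (λ a b → :- (a :- b) := :- a :- (:- b)) refl (seq x n) (seq y n)) (null-neg x≈y)

  ≈⇒≤ : ∀ x y → x ≈ y → x ≤ y
  ≈⇒≤ x y x≈y ε 0<ε =
    eventually-map (λ n → ∣p-q∣<ε⇒p<q+ε (seq x n) (seq y n)) (x≈y ε 0<ε)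

  ≤-trans : ∀ x y z → x ≤ y → y ≤ z → x ≤ z
  ≤-trans x y z x≤y y≤z ε 0<ε = eventually-zip
    (λ n x< y< → begin-strict
      seq x n                              <⟨ x< ⟩
      seq y n ℚ.+ ½ ℚ.* ε                  <⟨ ℚ.+-monoˡ-< (½ ℚ.* ε) y< ⟩
      seq z n ℚ.+ ½ ℚ.* ε ℚ.+ ½ ℚ.* ε      ≡⟨ ℚ.+-assoc (seq z n) (½ ℚ.* ε) (½ ℚ.* ε) ⟩
      seq z n ℚ.+ (½ ℚ.* ε ℚ.+ ½ ℚ.* ε)    ≡⟨ cong (seq z n ℚ.+_) (half+half ε) ⟩
      seq z n ℚ.+ ε                        ∎)
    (x≤y _ (half-positive 0<ε)) (y≤z _ (half-positive 0<ε))

  ≤-antisym : ∀ x y → x ≤ y → y ≤ x → x ≈ y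
  ≤-antisym x y x≤y y≤x ε 0<ε =
    eventually-zip (λ n → between⇒∣p-q∣<ε (seq x n) (seq y n)) (x≤y ε 0<ε) (y≤x ε 0<ε)

  +-mono-≤ : ∀ x x′ y y′ → x ≤ x′ → y ≤ y′ → x + y ≤ x′ + y′
  +-mono-≤ x x′ y y′ x≤x′ y≤y′ ε 0<ε = eventually-zip
    (λ n x< y< → begin-strict
      seq x n ℚ.+ seq y n                                      <⟨ ℚ.+-mono-< x< y< ⟩
      (seq x′ n ℚ.+ ½ ℚ.* ε) ℚ.+ (seq y′ n ℚ.+ ½ ℚ.* ε)        ≡⟨ solve 3 (λ a b ε →
        (a :+ con ½ :* ε) :+ (b :+ con ½ :* ε) := a :+ b :+ ε) refl (seq x′ n) (seq y′ n) ε ⟩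
      seq x′ n ℚ.+ seq y′ n ℚ.+ ε                              ∎)
    (x≤x′ _ (half-positive 0<ε)) (y≤y′ _ (half-positive 0<ε))

  -- A nonnegative real may have negative terms, but eventually only small ones. If a term of either
  -- factor is negative, it is small while the other is bounded, so the product is small; otherwise
  -- the product of the terms is nonnegative.
  *-nonneg : ∀ x y → 0ℝ ≤ x → 0ℝ ≤ y → 0ℝ ≤ x * y
  *-nonneg x y 0≤x 0≤y ε 0<ε =
    let Bx , 0<Bx , x≤Bx = seq-bounded x
        By , 0<By , y≤By = seq-bounded y
        δ , 0<δ , x*small = small-product 0<ε 0<Bx
        δ′ , 0<δ′ , y*small = small-product 0<ε 0<By
    in eventually-zip
      {P = λ n → (0ℚ ℚ.< seq x n ℚ.+ δ′) × ∣ seq x n ∣ ℚ.≤ Bx}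
      {Q = λ n → (0ℚ ℚ.< seq y n ℚ.+ δ) × ∣ seq y n ∣ ℚ.≤ By}
      (λ n (x> , x≤) (y> , y≤) →
        cases (seq x n) (seq y n) (x*small _ _ x≤) (y*small _ _ y≤) x> y>)
      (eventually-zip (λ _ → _,_) (0≤x δ′ 0<δ′) x≤Bx)
      (eventually-zip (λ _ → _,_) (0≤y δ 0<δ) y≤By)
    where
    negative-small : ∀ {p η} → p ℚ.≤ 0ℚ → 0ℚ ℚ.< p ℚ.+ η → ∣ p ∣ ℚ.< η
    negative-small {p} {η} p≤0 0<p+η = begin-strict
      ∣ p ∣             ≡⟨ ℚ.∣-p∣≡∣p∣ p ⟨
      ∣ ℚ.- p ∣         ≡⟨ ℚ.0≤p⇒∣p∣≡p (ℚ.neg-antimono-≤ p≤0) ⟩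
      ℚ.- p             ≡⟨ ℚ.+-identityʳ (ℚ.- p) ⟨
      ℚ.- p ℚ.+ 0ℚ      <⟨ ℚ.+-monoʳ-< (ℚ.- p) 0<p+η ⟩
      ℚ.- p ℚ.+ (p ℚ.+ η) ≡⟨ solve 2 (λ p η → :- p :+ (p :+ η) := η) refl p η ⟩
      η                 ∎
    cases : ∀ p q {δ δ′} →
      (∣ q ∣ ℚ.< δ → ∣ p ℚ.* q ∣ ℚ.< ε) → (∣ p ∣ ℚ.< δ′ → ∣ q ℚ.* p ∣ ℚ.< ε) →
      0ℚ ℚ.< p ℚ.+ δ′ → 0ℚ ℚ.< q ℚ.+ δ → 0ℚ ℚ.< p ℚ.* q ℚ.+ ε
    cases p q {δ} {δ′} q-small p-small p> q> with ℚ.≤-total 0ℚ p | ℚ.≤-total 0ℚ q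
    ... | inj₂ p≤0 | _ = ∣p∣<ε⇒-ε<p (subst (λ r → ∣ r ∣ ℚ.< ε) (ℚ.*-comm q p) (p-small (negative-small p≤0 p>)))
    ... | inj₁ _ | inj₂ q≤0 = ∣p∣<ε⇒-ε<p (q-small (negative-small q≤0 q>))
    ... | inj₁ 0≤p | inj₁ 0≤q = ℚ.+-mono-≤-< (ℚ.nonNegative⁻¹ (p ℚ.* q)
      {{ℚ.nonNeg*nonNeg⇒nonNeg p {{ℚ.nonNegative 0≤p}} q {{ℚ.nonNegative 0≤q}}}}) 0<ε

  -- Decides whether the sequence is eventually nonnegative. If it is not, no term beyond the Cauchy
  -- index for ε can reach ε, since all later terms would then be nonnegative.
  sign : ExcludedMiddle 0ℓ → ∀ x → 0ℝ ≤ x ⊎ x ≤ 0ℝ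
  sign em x with em {Eventually λ n → 0ℚ ℚ.≤ seq x n}
  ... | yes h = inj₁ λ ε 0<ε → eventually-map (λ n 0≤xn → ℚ.+-mono-≤-< 0≤xn 0<ε) h
  ... | no ¬h = inj₂ bound
    where
    bound : x ≤ 0ℝ
    bound ε 0<ε with N , c ← cauchy x ε 0<ε = N , λ n n≥ → ℚ.≰⇒> λ ε≤xn → ¬h (N , λ m m≥ → begin
      0ℚ               ≡⟨ ℚ.+-inverseʳ ε ⟨
      ε ℚ.- ε          ≤⟨ ℚ.+-monoˡ-≤ (ℚ.- ε) (subst (ℚ._≤ seq x n) (ℚ.+-identityˡ ε) ε≤xn) ⟩
      seq x n ℚ.- ε    ≤⟨ ℚ.<⇒≤ (p<q+ε⇒p-q<ε (seq x n) ε (subst (seq x n ℚ.<_)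
                            (ℚ.+-comm (seq x m) ε) (∣p-q∣<ε⇒p<q+ε (seq x n) (seq x m) (c n m n≥ m≥)))) ⟩
      seq x m          ∎)

  1≰0 : ¬ 1ℝ ≤ 0ℝ
  1≰0 h with N , h′ ← h 1ℚ (ℚ.positive⁻¹ 1ℚ) =
    ℚ.<-irrefl (sym (ℚ.+-identityˡ 1ℚ)) (h′ N ℕ.≤-refl)

ℝ-commutativeRing : CommutativeRing 0ℓ 0ℓ
ℝ-commutativeRing = record
  { Carrier = ℝ ; _≈_ = _≈_ ; _+_ = _+_ ; _*_ = _*_ ; -_ = -_ ; 0# = 0ℝ ; 1# = 1ℝ
  ; isCommutativeRing = record
    { isRing = record
      { +-isAbelianGroup = record
        { isGroup = record
          { isMonoid = record
            { isSemigroup = record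
              { isMagma = record
                { isEquivalence = record
                  { refl = λ {x} → ≈-refl x
                  ; sym = λ {x} {y} → ≈-sym x y
                  ; trans = λ {x} {y} {z} → ≈-trans x y z
                  }
                ; ∙-cong = λ {x} {x′} {y} {y′} → +-cong x x′ y y′
                }
              ; assoc = λ x y z → pointwise (x + y + z) (x + (y + z))
                  λ n → ℚ.+-assoc (seq x n) (seq y n) (seq z n)
              }
            ; identity = (λ x → pointwise (0ℝ + x) x λ n → ℚ.+-identityˡ (seq x n))
                       , (λ x → pointwise (x + 0ℝ) x λ n → ℚ.+-identityʳ (seq x n))
            }
          ; inverse = (λ x → pointwise (- x + x) 0ℝ λ n → ℚ.+-inverseˡ (seq x n))
                    , (λ x → pointwise (x + - x) 0ℝ λ n → ℚ.+-inverseʳ (seq x n))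
          ; ⁻¹-cong = λ {x} {y} → -‿cong x y
          }
        ; comm = λ x y → pointwise (x + y) (y + x) λ n → ℚ.+-comm (seq x n) (seq y n)
        }
      ; *-cong = λ {x} {x′} {y} {y′} → *-cong x x′ y y′
      ; *-assoc = λ x y z → pointwise (x * y * z) (x * (y * z))
          λ n → ℚ.*-assoc (seq x n) (seq y n) (seq z n)
      ; *-identity = (λ x → pointwise (1ℝ * x) x λ n → ℚ.*-identityˡ (seq x n))
                   , (λ x → pointwise (x * 1ℝ) x λ n → ℚ.*-identityʳ (seq x n))
      ; distrib = (λ x y z → pointwise (x * (y + z)) (x * y + x * z)
                    λ n → ℚ.*-distribˡ-+ (seq x n) (seq y n) (seq z n))
                , (λ x y z → pointwise ((y + z) * x) (y * x + z * x)
                    λ n → ℚ.*-distribʳ-+ (seq x n) (seq y n) (seq z n))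
      }
    ; *-comm = λ x y → pointwise (x * y) (y * x) λ n → ℚ.*-comm (seq x n) (seq y n)
    }
  }

ℝ-isPartialOrder : IsPartialOrder _≈_ _≤_
ℝ-isPartialOrder = record
  { isPreorder = record
    { isEquivalence = CommutativeRing.isEquivalence ℝ-commutativeRing
    ; reflexive = λ {x} {y} → ≈⇒≤ x y
    ; trans = λ {x} {y} {z} → ≤-trans x y z
    }
  ; antisym = λ {x} {y} → ≤-antisym x y
  }

reals : ExcludedMiddle 0ℓ → TotallyOrderedRing
reals em = record
  { commutativeRing = ℝ-commutativeRing
  ; _≤_             = _≤_
  ; isPartialOrder  = ℝ-isPartialOrder
  ; +-mono-≤        = λ {x} {x′} {y} {y′} → +-mono-≤ x x′ y y′
  ; *-nonneg        = λ {x} {y} → *-nonneg x y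
  ; sign            = sign em
  ; 1≰0             = 1≰0
  }

-- The two configurations

-- The staircase counts all pairs among the d + 1 vertices of the simplex; `r` counts one pair for
-- each point beyond the facet.
bound₁≡ : ∀ d r → bound₁ d (suc r) ≡ staircase (suc d) 0 ℕ.+ r
bound₁≡ d r = begin
  d ℕ.* (d ℕ.+ 1) / 2 ℕ.+ suc r ∸ 1  ≡⟨ cong (_∸ 1) (ℕ.+-suc (d ℕ.* (d ℕ.+ 1) / 2) r) ⟩
  d ℕ.* (d ℕ.+ 1) / 2 ℕ.+ r
    ≡⟨ cong (λ x → x / 2 ℕ.+ r) (trans (cong (d ℕ.*_) (ℕ.+-comm d 1)) (ℕ.*-comm d (suc d))) ⟩
  suc d ℕ.* d / 2 ℕ.+ r              ≡⟨ cong (ℕ._+ r) (triangle (suc d)) ⟩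
  staircase (suc d) 0 ℕ.+ r          ∎
  where open ≡.≡-Reasoning

-- With d = m + k there are m + 2k points; subtracting the pairs within the last 2k leaves those
-- whose smaller index is among the first m.
bound₂≡ : ∀ m k → bound₂ (m ℕ.+ k) k ≡ k ℕ.+ staircase m (2 ℕ.* k)
bound₂≡ m k = begin
  k ℕ.+ (m ℕ.+ k ℕ.+ k) ℕ.* (m ℕ.+ k ℕ.+ k ∸ 1) / 2 ∸ 2 ℕ.* k ℕ.* (2 ℕ.* k ∸ 1) / 2
    ≡⟨ cong₂ (λ x y → k ℕ.+ x ∸ y) (triangle (m ℕ.+ k ℕ.+ k)) (triangle (2 ℕ.* k)) ⟩
  k ℕ.+ staircase (m ℕ.+ k ℕ.+ k) 0 ∸ staircase (2 ℕ.* k) 0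
    ≡⟨ cong (λ x → k ℕ.+ staircase x 0 ∸ staircase (2 ℕ.* k) 0) m+k+k ⟩
  k ℕ.+ staircase (m ℕ.+ 2 ℕ.* k) 0 ∸ staircase (2 ℕ.* k) 0
    ≡⟨ cong (λ x → k ℕ.+ x ∸ staircase (2 ℕ.* k) 0) (staircase-split m (2 ℕ.* k)) ⟩
  k ℕ.+ (staircase m (2 ℕ.* k) ℕ.+ staircase (2 ℕ.* k) 0) ∸ staircase (2 ℕ.* k) 0
    ≡⟨ cong (_∸ staircase (2 ℕ.* k) 0) (ℕ.+-assoc k (staircase m (2 ℕ.* k)) (staircase (2 ℕ.* k) 0)) ⟨
  k ℕ.+ staircase m (2 ℕ.* k) ℕ.+ staircase (2 ℕ.* k) 0 ∸ staircase (2 ℕ.* k) 0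
    ≡⟨ ℕ.m+n∸n≡m (k ℕ.+ staircase m (2 ℕ.* k)) (staircase (2 ℕ.* k) 0) ⟩
  k ℕ.+ staircase m (2 ℕ.* k) ∎
  where
  open ≡.≡-Reasoning
  m+k+k : m ℕ.+ k ℕ.+ k ≡ m ℕ.+ 2 ℕ.* k
  m+k+k = trans (ℕ.+-assoc m k k) (cong (λ x → m ℕ.+ (k ℕ.+ x)) (sym (ℕ.+-identityʳ k)))

-- Here d - k is `m`, and d + 3k is m + 2 (2k), the factor in the closed form of the staircase.
bound₂′≡ : ∀ m k → bound₂′ (m ℕ.+ k) k ≡ k ℕ.+ staircase m (2 ℕ.* k)
bound₂′≡ m k = cong (k ℕ.+_) (begin
  (m ℕ.+ k ∸ k) ℕ.* (m ℕ.+ k ℕ.+ 3 ℕ.* k ∸ 1) / 2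
    ≡⟨ cong₂ (λ x y → x ℕ.* (y ∸ 1) / 2) (ℕ.m+n∸n≡m m k)
         (solve 2 (λ m k → m :+ k :+ con 3 :* k := m :+ con 2 :* (con 2 :* k)) refl m k) ⟩
  m ℕ.* (m ℕ.+ 2 ℕ.* (2 ℕ.* k) ∸ 1) / 2
    ≡⟨ staircase-closed m (2 ℕ.* k) ⟩
  staircase m (2 ℕ.* k) ∎)
  where
  open ≡.≡-Reasoning
  open ℕ-Solver

-- Classical least number principle: at each witness, excluded middle decides whether a smaller one
-- exists, and the descent is well founded.
minimum : ExcludedMiddle 0ℓ → ∀ (S : ℕ → Set) l → S l → ∃ λ m → IsMinimum S m × m ℕ.≤ l
minimum em S = <-rec _ search
  where
  search : ∀ l → (∀ {l′} → l′ ℕ.< l → S l′ → ∃ λ m → IsMinimum S m × m ℕ.≤ l′) →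
    S l → ∃ λ m → IsMinimum S m × m ℕ.≤ l
  search l smaller Sl with em {∃ λ l′ → l′ ℕ.< l × S l′}
  ... | yes (l′ , l′<l , Sl′) with m , min , m≤l′ ← smaller l′<l Sl′ =
    m , min , ℕ.≤-trans m≤l′ (ℕ.<⇒≤ l′<l)
  ... | no none = l , (Sl , λ l′ Sl′ → ℕ.≮⇒≥ λ l′<l → none (l′ , l′<l , Sl′)) , ℕ.≤-refl

-- Configurations in real space and their antipodal pairs

module RealConfigurations (em : ExcludedMiddle 0ℓ) where
  open ConvexGeometry (reals em) hiding (_≐_)

  point-∈conv : ∀ {d n} (X : Family d n) i → X i ∈conv X
  point-∈conv X i = δ i , proj₁ (δ-convex i) , proj₂ (δ-convex i) , combine-δ X i

  -- Each point is a vertex, as the unique maximiser of its functional over the hull. Conversely, a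
  -- supporting hyperplane meeting the hull only in `p` contains a point of `X` by attainment of the
  -- bound, and that point must be `p`.
  exposed-config : ∀ {d n} (u X : Family d n) → Exposes u X → (∀ i → ∃ λ j → j ≢ i) →
    (∀ y → y ∈aff X) → Config d n
  exposed-config {d} {n} u X exposes other spanning = record
    { points         = X
    ; distinct       = λ i j Xi≋Xj → decidable-stable (i Fin.≟ j)
                         λ i≢j → exposed-distinct {u = u} {X} exposes i≢j Xi≋Xj
    ; full           = spanning
    ; strictlyConvex = λ p → mk⇔ (λ (i , p≋Xi) → vertex p i p≋Xi) (attained p)
    }
    where
    vertex : ∀ p i → p ≋ X i → IsVertex X p
    vertex p i p≋Xi = H , (((X i , point-∈conv X i , ≈-refl (dot (u i) (X i))) , inj₁ below)) ,
      λ y → mk⇔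
        (λ ((w , 0≤w , Σw≈1 , y≋) , y∈H) c → ≈-trans (y c) (X i c) (p c)
          (unique-maximum {X = X} {w} (0≤w , Σw≈1) {y} y≋ (u i) {i} (λ l → exposes l i) y∈H c)
          (≈-sym (p c) (X i c) (p≋Xi c)))
        (λ y≋p → let y≋Xi = λ c → ≈-trans (y c) (p c) (X i c) (y≋p c) (p≋Xi c) in
          (δ i , proj₁ (δ-convex i) , proj₂ (δ-convex i) , λ c →
            ≈-trans (y c) (X i c) (combination (δ i) X c) (y≋Xi c) (combine-δ X i c))
          , ⟪⟫-congʳ (u i) {y} {X i} y≋Xi)
      where
      H : Hyperplane d
      H = record { normal = u i ; offset = dot (u i) (X i)
                 ; normal≉0 = exposing≉0 {u = u} {X} exposes (proj₂ (other i)) }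

      below : ∀ y → y ∈conv X → dot (u i) y ≤ dot (u i) (X i)
      below y (w , 0≤w , Σw≈1 , y≋) =
        convex-≤ {X = X} {w} (0≤w , Σw≈1) {y} y≋ (u i) {dot (u i) (X i)}
          (exposed-≤ {u = u} {X} exposes Fin._≟_ i)

    attained : ∀ p → IsVertex X p → ∃ λ i → p ≋ X i
    attained p (H , (_ , side) , only-p) with Equivalence.from (only-p p) (λ c → ≈-refl (p c))
    ... | (w , 0≤w , Σw≈1 , p≋) , p∈H = l , λ c → ≈-sym (X l c) (p c) (Xl≋p c)
      where
      on-H : (∀ y → y ∈conv X → dot (normal H) y ≤ offset H) ⊎
             (∀ y → y ∈conv X → offset H ≤ dot (normal H) y) → ∃ λ l → X l ∈ᴴ H
      on-H (inj₁ below) = bound-attained {X = X} {w} (0≤w , Σw≈1) {p} p≋ (normal H)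
        {offset H} (λ l → below (X l) (point-∈conv X l)) p∈H
      on-H (inj₂ above) = lower-bound-attained {X = X} {w} (0≤w , Σw≈1) {p} p≋ (normal H)
        {offset H} (λ l → above (X l) (point-∈conv X l)) p∈H

      l : Fin n
      l = proj₁ (on-H side)

      Xl≋p : X l ≋ p
      Xl≋p = Equivalence.to (only-p (X l)) (point-∈conv X l , proj₂ (on-H side))

  antipodal⇒separated : ∀ {d n} (C : Config d n) {i j} → StrictlyAntipodal (points C) i j →
    ∃ λ a → Separates a (points C) i j
  antipodal⇒separated C {i} {j}
    (Xi≉Xj , H′ , H″ , _ , (t , _ , H′≈tH″) , (_ , side′) , (_ , side″) , (i∈ , _ , only) , (j∈ , _ , _)) =
    separate {a = normal H′} {offset H′} {normal H″} {offset H″} {t} {points C}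
      (one-sided H′ side′) (one-sided H″ side″) H′≈tH″ i∈ j∈
      (λ l l∈ → distinct C l i (only l l∈)) λ { refl → Xi≉Xj λ c → ≈-refl (points C i c) }
    where
    one-sided : ∀ H → (∀ y → y ∈conv points C → dot (normal H) y ≤ offset H) ⊎
                      (∀ y → y ∈conv points C → offset H ≤ dot (normal H) y) →
                OneSided (normal H) (offset H) (points C)
    one-sided H = Sum.map (λ below l → below (points C l) (point-∈conv (points C) l))
                          (λ above l → above (points C l) (point-∈conv (points C) l))

  module SplitConfig {d m n : ℕ} (X u : Fin m ⊎ Fin n → Point d) (exposes : Exposes u X)
                     (other : ∀ (s : Fin m ⊎ Fin n) → ∃ λ t → t ≢ s) 
                     (spanning : ∀ y → y ∈aff (X ∘ splitAt m)) where

    splitAt-injective : ∀ {i j : Fin (m ℕ.+ n)} → splitAt m i ≡ splitAt m j → i ≡ j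
    splitAt-injective {i} {j} eq = ≡.trans (≡.sym (Fin.join-splitAt m n i))
      (≡.trans (≡.cong (join m n) eq) (Fin.join-splitAt m n j))

    config : Config d (m ℕ.+ n)
    config = exposed-config (u ∘ splitAt m) (X ∘ splitAt m)
      (λ l p l≢p → exposes (splitAt m l) (splitAt m p) (l≢p ∘ splitAt-injective))
      (λ i → let t , t≢ = other (splitAt m i) in
        join m n t , λ eq → t≢ (≡.trans (≡.sym (Fin.splitAt-join m n t)) (≡.cong (splitAt m) eq)))
      spanning

    -- Only later indices qualify, so each unordered pair belongs to the row of its earlier point.
    Partner : Fin m ⊎ Fin n → Fin (m ℕ.+ n) → Set
    Partner s j = join m n s Fin.< j × StrictlyAntipodal (points config) (join m n s) j

    partner-separated : ∀ s {j} → Partner s j → ∃ λ a → Separates a X s (splitAt m j)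
    partner-separated s {j} (_ , antipodal) =
      proj₁ separated , Separates-split {d = d} {proj₁ separated} {m} {n} {X} s {j} (proj₂ separated)
      where
      separated : ∃ λ a → Separates a (X ∘ splitAt m) (join m n s) j
      separated = antipodal⇒separated config {join m n s} {j} antipodal

    partner-≢ : ∀ s {j} → Partner s j → splitAt m j ≢ s
    partner-≢ s {j} (s<j , _) refl = Fin.<-irrefl (Fin.join-splitAt m n j) s<j

    -- Row bounds are required for every decision procedure, which includes the one that `sa`
    -- obtains from excluded middle.
    sa-≤ : (b : Fin m ⊎ Fin n → ℕ) →
      (∀ s (P? : Decidable (Partner s)) → length (filter P? (allFin (m ℕ.+ n))) ℕ.≤ b s) →
      sa em (points config) ℕ.≤ sumℕ (b ∘ inj₁) ℕ.+ sumℕ (b ∘ inj₂)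
    sa-≤ b rows = pairs-≤ m
      {Q = λ (i , j) → i Fin.< j × StrictlyAntipodal (points config) i j} _ b λ s → rows s _

  positive-multiple : ∀ n → 0ℚ ℚ.< seq (suc n ×′ 1ℝ) 0
  positive-multiple zero    = ℚ.positive⁻¹ 1ℚ
  positive-multiple (suc n) = ℚ.+-mono-<-≤ (ℚ.positive⁻¹ 1ℚ) (ℚ.<⇒≤ (positive-multiple n))

  seq-multiple : ∀ n i → seq (n ×′ 1ℝ) i ≡ seq (n ×′ 1ℝ) 0
  seq-multiple zero    i = refl
  seq-multiple (suc n) i = ≡.cong (1ℚ ℚ.+_) (seq-multiple n i)

  -- A multiple of 1 is a constant sequence of positive rationals, so the rational inverse of that
  -- constant suffices.
  multiple-inverse : ∀ n → ∃ λ r → r * (suc n ×′ 1ℝ) ≈ 1ℝ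
  multiple-inverse n = fromℚ (ℚ.1/ q) , pointwise (fromℚ (ℚ.1/ q) * (suc n ×′ 1ℝ)) 1ℝ
    λ i → ≡.trans (≡.cong (ℚ.1/ q ℚ.*_) (seq-multiple (suc n) i)) (ℚ.*-inverseˡ q)
    where
    q : ℚ
    q = seq (suc n ×′ 1ℝ) 0
    instance
      q-nonZero : ℚ.NonZero q
      q-nonZero = ℚ.pos⇒nonZero q {{ℚ.positive (positive-multiple n)}}

  -- The dimension is `suc d`, which makes its multiple of 1 invertible, and `r` is k - 1.
  module CappedSimplexConfig {r d} (r≤d : r ℕ.≤ suc d) (3≤d : 3 ℕ.≤ suc d) where

    ι : Fin r → Fin (suc d)
    ι i = Fin.inject≤ i r≤d

    module Capped = CappedSimplex ι (Fin.inject≤-injective r≤d r≤d _ _) 3≤d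

    other : ∀ (s : Fin r ⊎ Fin (suc (suc d))) → ∃ λ t → t ≢ s
    other (near i) = apex , λ ()
    other apex     = base zero , λ ()
    other (base j) = apex , λ ()

    open SplitConfig Capped.points Capped.normals Capped.exposes other
      (Capped.affinely-spanning (proj₁ (multiple-inverse d)) (proj₂ (multiple-inverse d))) public

    near-partner : ∀ i {j} → Partner (near i) j → j ≡ r ↑ʳ zero
    near-partner i {j} partner = ≡.sym (Fin.splitAt⁻¹-↑ʳ (Capped.near-partner {proj₁ separated} {i} (splitAt r j)
      (partner-≢ (near i) partner) (proj₂ separated)))
      where
      separated : ∃ λ a → Separates a Capped.points (near i) (splitAt r j)
      separated = partner-separated (near i) partner

    -- Near points come first in the order, so every pair involving one is counted in a near row,
    -- where the apex is the sole possible partner. The other rows are the steps of the staircase on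
    -- the simplex vertices; `+ 0` matches its form.
    row-bound : Fin r ⊎ Fin (suc (suc d)) → ℕ
    row-bound (inj₁ i) = 1
    row-bound (inj₂ t) = suc (suc d) ℕ.+ 0 ∸ suc (toℕ t)

    rows : ∀ s (P? : Decidable (Partner s)) → length (filter P? (allFin (r ℕ.+ suc (suc d)))) ℕ.≤ row-bound s
    rows (inj₁ i) P? = filter-single-≤ P? (λ j → j) (r ↑ʳ zero) λ j → near-partner i
    rows (inj₂ t) P? = ℕ.≤-trans (filter-tail-≤ P? (λ j → j) λ j → proj₁) (ℕ.≤-reflexive eq)
      where
      open ≡.≡-Reasoning
      eq : r ℕ.+ suc (suc d) ∸ suc (toℕ (r ↑ʳ t)) ≡ suc (suc d) ℕ.+ 0 ∸ suc (toℕ t)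
      eq = begin
        r ℕ.+ suc (suc d) ∸ suc (toℕ (r ↑ʳ t))
          ≡⟨ ≡.cong (λ x → r ℕ.+ suc (suc d) ∸ suc x) (Fin.toℕ-↑ʳ r t) ⟩
        r ℕ.+ suc (suc d) ∸ suc (r ℕ.+ toℕ t)
          ≡⟨ ≡.cong (r ℕ.+ suc (suc d) ∸_) (ℕ.+-suc r (toℕ t)) ⟨
        r ℕ.+ suc (suc d) ∸ (r ℕ.+ suc (toℕ t))    ≡⟨ ℕ.[m+n]∸[m+o]≡n∸o r (suc (suc d)) (suc (toℕ t)) ⟩
        suc (suc d) ∸ suc (toℕ t)
          ≡⟨ ≡.cong (_∸ suc (toℕ t)) (ℕ.+-identityʳ (suc (suc d))) ⟨
        suc (suc d) ℕ.+ 0 ∸ suc (toℕ t)            ∎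

    sa-bound : sa em (points config) ℕ.≤ bound₁ (suc d) (suc r)
    sa-bound = begin
      sa em (points config)                              ≤⟨ sa-≤ row-bound rows ⟩
      sumℕ {r} (λ _ → 1) ℕ.+ staircase (suc (suc d)) 0
        ≡⟨ ≡.cong (ℕ._+ staircase (suc (suc d)) 0) (sumℕ-const r 1) ⟩
      r ℕ.* 1 ℕ.+ staircase (suc (suc d)) 0
        ≡⟨ ≡.cong (ℕ._+ staircase (suc (suc d)) 0) (ℕ.*-identityʳ r) ⟩
      r ℕ.+ staircase (suc (suc d)) 0                    ≡⟨ ℕ.+-comm r (staircase (suc (suc d)) 0) ⟩
      staircase (suc (suc d)) 0 ℕ.+ r                    ≡⟨ bound₁≡ (suc d) r ⟨
      bound₁ (suc d) (suc r)                             ∎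
      where open ℕ.≤-Reasoning

  -- The number of antipodal pairs is the successor `K` of the parameter: affine spanning needs at
  -- least one such pair.
  module CrossConfig (m k : ℕ) where

    K : ℕ
    K = suc k

    module Crossed = Cross m K

    other : ∀ (s : Fin (m ℕ.+ K) ⊎ Fin K) → ∃ λ t → t ≢ s
    other (plus c)  = minus zero , λ ()
    other (minus i) = plus (m ↑ʳ zero) , λ ()

    halves : fromℚ ½ + fromℚ ½ ≈ 1ℝ
    halves = pointwise (fromℚ ½ + fromℚ ½) 1ℝ λ _ → refl

    open SplitConfig Crossed.points Crossed.points Crossed.exposes other
      (Crossed.affinely-spanning (fromℚ ½) halves zero) public

    -- A separated partner would be a plus point, but these precede all minus points while a partner
    -- must come later.
    minus-partner : ∀ i {j} → ¬ Partner (minus i) j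
    minus-partner i {j} partner = ℕ.<-asym (proj₁ partner) (≡.subst₂ ℕ._<_
      (≡.trans (≡.sym (Fin.toℕ-↑ˡ (proj₁ j≡plus) K)) (≡.cong toℕ (Fin.splitAt⁻¹-↑ˡ (proj₂ j≡plus))))
      refl (↑ˡ-<-↑ʳ (proj₁ j≡plus) i))
      where
      separated : ∃ λ a → Separates a Crossed.points (minus i) (splitAt (m ℕ.+ K) j)
      separated = partner-separated (minus i) partner

      j≡plus : ∃ λ c → splitAt (m ℕ.+ K) j ≡ plus c
      j≡plus = Crossed.minus-partner {proj₁ separated} {i} (splitAt (m ℕ.+ K) j) (proj₂ separated)

    -- The alternative to the antipode is one of the first `m` points, and those come earlier in the
    -- order.
    plus-partner : ∀ i {j} → Partner (plus (m ↑ʳ i)) j → j ≡ (m ℕ.+ K) ↑ʳ i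
    plus-partner i {j} partner = cases
      (Crossed.plus-partner {proj₁ separated} {i} (splitAt (m ℕ.+ K) j) (proj₂ separated))
      where
      separated : ∃ λ a → Separates a Crossed.points (plus (m ↑ʳ i)) (splitAt (m ℕ.+ K) j)
      separated = partner-separated (plus (m ↑ʳ i)) partner

      cases : splitAt (m ℕ.+ K) j ≡ minus i ⊎ (∃ λ e → splitAt (m ℕ.+ K) j ≡ plus (e ↑ˡ K)) → j ≡ (m ℕ.+ K) ↑ʳ i
      cases (inj₁ eq)       = ≡.sym (Fin.splitAt⁻¹-↑ʳ eq)
      cases (inj₂ (e , eq)) = contradiction (proj₁ partner) (ℕ.<-asym (≡.subst₂ ℕ._<_
        (≡.trans (≡.sym (≡.trans (Fin.toℕ-↑ˡ (e ↑ˡ K) K) (Fin.toℕ-↑ˡ e K))) (≡.cong toℕ (Fin.splitAt⁻¹-↑ˡ eq)))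
        (≡.sym (Fin.toℕ-↑ˡ (m ↑ʳ i) K)) (↑ˡ-<-↑ʳ e i)))

    first-bound : Fin m ⊎ Fin K → ℕ
    first-bound (inj₁ e) = m ℕ.+ 2 ℕ.* K ∸ suc (toℕ e)
    first-bound (inj₂ i) = 1

    row-bound : Fin (m ℕ.+ K) ⊎ Fin K → ℕ
    row-bound (plus c)  = first-bound (splitAt m c)
    row-bound (minus i) = 0

    size : m ℕ.+ K ℕ.+ K ≡ m ℕ.+ 2 ℕ.* K
    size = ≡.trans (ℕ.+-assoc m K K) (≡.cong (λ x → m ℕ.+ (K ℕ.+ x)) (≡.sym (ℕ.+-identityʳ K)))

    first-rows : ∀ t (P? : Decidable (Partner (plus (join m K t)))) →
      length (filter P? (allFin (m ℕ.+ K ℕ.+ K))) ℕ.≤ first-bound t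
    first-rows (inj₁ e) P? = ℕ.≤-trans (filter-tail-≤ P? (λ j → j) λ j → proj₁)
      (ℕ.≤-reflexive (≡.cong₂ (λ x y → x ∸ suc y) size
        (≡.trans (Fin.toℕ-↑ˡ (e ↑ˡ K) K) (Fin.toℕ-↑ˡ e K))))
    first-rows (inj₂ i) P? = filter-single-≤ P? (λ j → j) ((m ℕ.+ K) ↑ʳ i) λ j → plus-partner i

    rows : ∀ s (P? : Decidable (Partner s)) → length (filter P? (allFin (m ℕ.+ K ℕ.+ K))) ℕ.≤ row-bound s
    -- The index `c` is exchanged for the join of its split, where its block is visible.
    rows (plus c) = ≡.subst (λ c′ → (P? : Decidable (Partner (plus c′))) →
        length (filter P? (allFin (m ℕ.+ K ℕ.+ K))) ℕ.≤ first-bound (splitAt m c))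
      (Fin.join-splitAt m K c) (first-rows (splitAt m c))
    rows (minus i) P? = filter-none-≤ P? (λ j → j) λ j → minus-partner i

    sa-bound : sa em (points config) ℕ.≤ bound₂ (m ℕ.+ K) K
    sa-bound = begin
      sa em (points config)
        ≤⟨ sa-≤ row-bound rows ⟩
      sumℕ (first-bound ∘ splitAt m) ℕ.+ sumℕ {K} (λ _ → 0)
        ≡⟨ ≡.cong₂ ℕ._+_ (sum-splitAt ℕ.+-0-monoid m first-bound) (≡.trans (sumℕ-const K 0) (ℕ.*-zeroʳ K)) ⟩
      staircase m (2 ℕ.* K) ℕ.+ sumℕ {K} (λ _ → 1) ℕ.+ 0
        ≡⟨ ℕ.+-identityʳ _ ⟩
      staircase m (2 ℕ.* K) ℕ.+ sumℕ {K} (λ _ → 1)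
        ≡⟨ ≡.cong (staircase m (2 ℕ.* K) ℕ.+_) (≡.trans (sumℕ-const K 1) (ℕ.*-identityʳ K)) ⟩
      staircase m (2 ℕ.* K) ℕ.+ K
        ≡⟨ ℕ.+-comm (staircase m (2 ℕ.* K)) K ⟩
      K ℕ.+ staircase m (2 ℕ.* K)
        ≡⟨ bound₂≡ m K ⟨
      bound₂ (m ℕ.+ K) K ∎
      where open ℕ.≤-Reasoning

  -- The size enters through an equation because the capped simplex has r + (d + 1) points, which
  -- equals d + k only up to arithmetic.
  minimum-≤ : ∀ {d n n′ b} → n ≡ n′ → (C : Config d n) → sa em (points C) ℕ.≤ b →
    ∃ λ m → IsMinSa em d n′ m × m ℕ.≤ b
  minimum-≤ refl C sa≤b with m , min , m≤sa ← minimum em _ (sa em (points C)) (C , refl) =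
    m , min , ℕ.≤-trans m≤sa sa≤b

  upper-bound₁ : ∀ d k → 2 ℕ.≤ k → k ℕ.≤ d ∸ 1 → ∃ λ m → IsMinSa em d (d ℕ.+ k) m × m ℕ.≤ bound₁ d k
  upper-bound₁ (suc d) (suc r) 2≤k k≤d = minimum-≤ size config sa-bound
    where
    -- The dimension is at least 3 because it exceeds k and k is at least 2.
    open CappedSimplexConfig {r} {d}
      (ℕ.≤-trans (ℕ.n≤1+n r) (ℕ.≤-trans k≤d (ℕ.n≤1+n d))) (s≤s (ℕ.≤-trans 2≤k k≤d))
    size : r ℕ.+ suc (suc d) ≡ suc d ℕ.+ suc r
    size = ≡.trans (ℕ.+-suc r (suc d)) (ℕ.+-comm (suc r) (suc d))

  upper-bound₂ : ∀ m k → 1 ℕ.≤ k → ∃ λ l → IsMinSa em (m ℕ.+ k) (m ℕ.+ k ℕ.+ k) l × l ℕ.≤ bound₂ (m ℕ.+ k) k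
  upper-bound₂ m (suc k) _ = minimum-≤ refl config sa-bound
    where open CrossConfig m k

-- Growth of the bounds

-- `fromℕ` normalises its fraction; passing to unnormalised rationals exposes the denominator 1 for
-- comparisons and products.
toℚᵘ-fromℕ : ∀ m → ℚ.toℚᵘ (fromℕ m) ℚᵘ.≃ ℚᵘ.mkℚᵘ (+ m) 0
toℚᵘ-fromℕ m = ℚ.toℚᵘ-fromℚᵘ (ℚᵘ.mkℚᵘ (+ m) 0)

fromℕ-mono-≤ : ∀ {m n} → m ℕ.≤ n → fromℕ m ℚ.≤ fromℕ n
fromℕ-mono-≤ {m} {n} m≤n = ℚ.toℚᵘ-cancel-≤
  (ℚᵘ.≤-respˡ-≃ (ℚᵘ.≃-sym (toℚᵘ-fromℕ m)) (ℚᵘ.≤-respʳ-≃ (ℚᵘ.≃-sym (toℚᵘ-fromℕ n))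
    (ℚᵘ.*≤* (ℤ.*-monoʳ-≤-nonNeg (+ 1) (ℤ.+≤+ m≤n)))))

fromℕ-* : ∀ m n → fromℕ (m ℕ.* n) ≡ fromℕ m ℚ.* fromℕ n
fromℕ-* m n = ℚ.toℚᵘ-injective (begin-equality
  ℚ.toℚᵘ (fromℕ (m ℕ.* n))                     ≃⟨ toℚᵘ-fromℕ (m ℕ.* n) ⟩
  ℚᵘ.mkℚᵘ (+ (m ℕ.* n)) 0                      ≃⟨ ℚᵘ.*≡* (≡.cong (ℤ._* + 1) (ℤ.pos-* m n)) ⟩
  ℚᵘ.mkℚᵘ (+ m) 0 ℚᵘ.* ℚᵘ.mkℚᵘ (+ n) 0         ≃⟨ ℚᵘ.*-cong (toℚᵘ-fromℕ m) (toℚᵘ-fromℕ n) ⟨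
  ℚ.toℚᵘ (fromℕ m) ℚᵘ.* ℚ.toℚᵘ (fromℕ n)       ≃⟨ ℚ.toℚᵘ-homo-* (fromℕ m) (fromℕ n) ⟨
  ℚ.toℚᵘ (fromℕ m ℚ.* fromℕ n)                 ∎)
  where open ℚᵘ.≤-Reasoning

½*-fromℕ-≤ : ∀ m n → m ℕ.≤ 2 ℕ.* n → ½ ℚ.* fromℕ m ℚ.≤ fromℕ n
½*-fromℕ-≤ m n m≤2n = begin
  ½ ℚ.* fromℕ m                    ≤⟨ ℚ.*-monoˡ-≤-nonNeg ½ (fromℕ-mono-≤ m≤2n) ⟩
  ½ ℚ.* fromℕ (2 ℕ.* n)            ≡⟨ ≡.cong (½ ℚ.*_) (fromℕ-* 2 n) ⟩
  ½ ℚ.* (fromℕ 2 ℚ.* fromℕ n)      ≡⟨ ℚ.*-assoc ½ (fromℕ 2) (fromℕ n) ⟨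
  1ℚ ℚ.* fromℕ n                   ≡⟨ ℚ.*-identityˡ (fromℕ n) ⟩
  fromℕ n                          ∎
  where open ℚ.≤-Reasoning

module _ (R : ℕ → ℕ → Set) {f g : ℕ → ℕ → ℕ} where

  -- Both parts share the lower constant 1/2, so the estimates become inequalities of natural
  -- numbers; the form `suc c` makes the upper constant positive.
  Θ-intro : ∀ c → (∀ d k → R d k → g d k ℕ.≤ 2 ℕ.* f d k × f d k ℕ.≤ suc c ℕ.* g d k) → Θ-on R f g
  Θ-intro c bounds = ½ , fromℕ (suc c) , ℚ.positive⁻¹ ½
    , ℚ.<-≤-trans (ℚ.positive⁻¹ 1ℚ) (fromℕ-mono-≤ {1} {suc c} (s≤s ℕ.z≤n))
    , λ d k r → let g≤2f , f≤cg = bounds d k r in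
        ½*-fromℕ-≤ (g d k) (f d k) g≤2f , ≡.subst (fromℕ (f d k) ℚ.≤_) (fromℕ-* (suc c) (g d k)) (fromℕ-mono-≤ f≤cg)

-- With 2S = D (D + 1), the lower estimate is D² ≤ 2S, and the upper one is S + r ≤ 2S + D ≤ 3D².
bound₁-growth : ∀ d r → r ℕ.≤ suc d →
  suc d ℕ.^ 2 ℕ.≤ 2 ℕ.* bound₁ (suc d) (suc r) × bound₁ (suc d) (suc r) ℕ.≤ 3 ℕ.* suc d ℕ.^ 2
bound₁-growth d r r≤D rewrite bound₁≡ (suc d) r = lower , upper
  where
  open ℕ.≤-Reasoning
  open ℕ-Solver
  D S : ℕ
  D = suc d
  S = staircase (suc D) 0

  S*2 : S ℕ.* 2 ≡ suc D ℕ.* D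
  S*2 = ≡.trans (staircase*2 (suc D) 0) (≡.cong (suc D ℕ.*_) (ℕ.+-identityʳ D))

  lower : D ℕ.^ 2 ℕ.≤ 2 ℕ.* (S ℕ.+ r)
  lower = begin
    D ℕ.^ 2             ≡⟨ ≡.cong (D ℕ.*_) (ℕ.*-identityʳ D) ⟩
    D ℕ.* D             ≤⟨ ℕ.m≤n+m (D ℕ.* D) D ⟩
    suc D ℕ.* D         ≡⟨ S*2 ⟨
    S ℕ.* 2             ≡⟨ ℕ.*-comm S 2 ⟩
    2 ℕ.* S             ≤⟨ ℕ.*-monoʳ-≤ 2 (ℕ.m≤m+n S r) ⟩
    2 ℕ.* (S ℕ.+ r)     ∎

  D≤D² : D ℕ.≤ D ℕ.* D
  D≤D² = ℕ.m≤m*n D D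

  upper : S ℕ.+ r ℕ.≤ 3 ℕ.* D ℕ.^ 2
  upper = begin
    S ℕ.+ r                        ≤⟨ ℕ.+-mono-≤ (ℕ.m≤m*n S 2) r≤D ⟩
    S ℕ.* 2 ℕ.+ D                  ≡⟨ ≡.cong (ℕ._+ D) S*2 ⟩
    suc D ℕ.* D ℕ.+ D              ≤⟨ ℕ.+-mono-≤ (ℕ.+-monoˡ-≤ (D ℕ.* D) D≤D²) D≤D² ⟩
    D ℕ.* D ℕ.+ D ℕ.* D ℕ.+ D ℕ.* D
      ≡⟨ solve 1 (λ D → D :* D :+ D :* D :+ D :* D := con 3 :* (D :* (D :* con 1))) refl D ⟩
    3 ℕ.* D ℕ.^ 2                  ∎

-- With M = d - k = m + 1 one has 2S = M (m + 4k). From k ≥ 1 follows d ≤ m + 4k, the lower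
-- estimate; from M ≥ 1 follow k ≤ M d and m + 4k ≤ 4d, the upper one.
bound₂′-growth : ∀ m k → 1 ℕ.≤ k →
  (suc m ℕ.+ k ∸ k) ℕ.* (suc m ℕ.+ k) ℕ.≤ 2 ℕ.* bound₂′ (suc m ℕ.+ k) k ×
  bound₂′ (suc m ℕ.+ k) k ℕ.≤ 5 ℕ.* ((suc m ℕ.+ k ∸ k) ℕ.* (suc m ℕ.+ k))
bound₂′-growth m k 1≤k rewrite bound₂′≡ (suc m) k | ℕ.m+n∸n≡m (suc m) k = lower , upper
  where
  open ℕ.≤-Reasoning
  open ℕ-Solver
  M d S : ℕ
  M = suc m
  d = M ℕ.+ k
  S = staircase M (2 ℕ.* k)

  lower : M ℕ.* d ℕ.≤ 2 ℕ.* (k ℕ.+ S)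
  lower = begin
    M ℕ.* (suc m ℕ.+ k)                        ≡⟨ ≡.cong (M ℕ.*_) (ℕ.+-suc m k) ⟨
    M ℕ.* (m ℕ.+ suc k)
      ≤⟨ ℕ.*-monoʳ-≤ M (ℕ.+-monoʳ-≤ m (ℕ.+-mono-≤ 1≤k (ℕ.m≤m+n k (2 ℕ.* k)))) ⟩
    M ℕ.* (m ℕ.+ (k ℕ.+ (k ℕ.+ 2 ℕ.* k)))
      ≡⟨ ≡.cong (M ℕ.*_) (solve 2 (λ m k → m :+ (k :+ (k :+ con 2 :* k)) := m :+ con 2 :* (con 2 :* k)) refl m k) ⟩
    M ℕ.* (m ℕ.+ 2 ℕ.* (2 ℕ.* k))              ≡⟨ staircase*2 M (2 ℕ.* k) ⟨
    S ℕ.* 2                                    ≡⟨ ℕ.*-comm S 2 ⟩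
    2 ℕ.* S                                    ≤⟨ ℕ.*-monoʳ-≤ 2 (ℕ.m≤n+m S k) ⟩
    2 ℕ.* (k ℕ.+ S)                            ∎

  upper : k ℕ.+ S ℕ.≤ 5 ℕ.* (M ℕ.* d)
  upper = begin
    k ℕ.+ S
      ≤⟨ ℕ.+-mono-≤ (ℕ.≤-trans (ℕ.m≤n+m k M) (ℕ.m≤n*m d M)) (ℕ.m≤m*n S 2) ⟩
    M ℕ.* d ℕ.+ S ℕ.* 2                        ≡⟨ ≡.cong (M ℕ.* d ℕ.+_) (staircase*2 M (2 ℕ.* k)) ⟩
    M ℕ.* d ℕ.+ M ℕ.* (m ℕ.+ 2 ℕ.* (2 ℕ.* k))  ≤⟨ ℕ.+-monoʳ-≤ (M ℕ.* d) (ℕ.*-monoʳ-≤ M (ℕ.+-monoˡ-≤ (2 ℕ.* (2 ℕ.* k))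
                                                    (ℕ.≤-trans (ℕ.n≤1+n m) (ℕ.m≤n*m M 4)))) ⟩
    M ℕ.* d ℕ.+ M ℕ.* (4 ℕ.* M ℕ.+ 2 ℕ.* (2 ℕ.* k))
      ≡⟨ solve 2 (λ M k → M :* (M :+ k) :+ M :* (con 4 :* M :+ con 2 :* (con 2 :* k)) := con 5 :* (M :* (M :+ k))) refl M k ⟩
    5 ℕ.* (M ℕ.* d)                            ∎

-- The two ranges of k

k<d : ∀ {d k} → 2 ℕ.≤ k → k ℕ.≤ d ∸ 1 → k ℕ.< d
k<d {zero}  2≤k k≤0 = contradiction (ℕ.≤-trans 2≤k k≤0) λ ()
k<d {suc d} _   k≤d = s≤s k≤d

-- Writing d as a successor plus k removes the truncated difference d - k and records that it is
-- positive.
split-dimension : ∀ {d k} → k ℕ.< d → ∃ λ m → suc m ℕ.+ k ≡ d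
split-dimension {d} {k} k<d = d ∸ suc k , ≡.trans (≡.sym (ℕ.+-suc (d ∸ suc k) k)) (ℕ.m∸n+n≡m k<d)

theorem2p3 : (em : ExcludedMiddle 0ℓ) →
    ((∀ d k → Range₁ d k → ∃ λ m → IsMinSa em d (d ℕ.+ k) m × m ℕ.≤ bound₁ d k)
    × Θ-on Range₁ bound₁ (λ d k → d ℕ.^ 2))
    ×
    ((∀ d k → Range₂ d k →
    (∃ λ m → IsMinSa em d (d ℕ.+ k) m × m ℕ.≤ bound₂ d k) × bound₂ d k ≡ bound₂′ d k)
    × Θ-on Range₂ bound₂′ (λ d k → (d ℕ.∸ k) ℕ.* d))
theorem2p3 em =
  ( (λ d k (2≤k , k≤d-1 , _) → upper-bound₁ d k 2≤k k≤d-1)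
  -- `Θ-intro` takes the predecessor of the upper constant, which is 3 here and 5 in the second
  -- part.
  , Θ-intro Range₁ {bound₁} {λ d k → d ℕ.^ 2} 2 growth₁ ) ,
  ( (λ d k (2≤k , k≤d-1 , _) → part₂ d k 2≤k (k<d 2≤k k≤d-1))
  , Θ-intro Range₂ {bound₂′} {λ d k → (d ∸ k) ℕ.* d} 4
      λ d k (2≤k , k≤d-1 , _) → growth₂ d k 2≤k (k<d 2≤k k≤d-1) )
  where
  open RealConfigurations em

  growth₁ : ∀ d k → Range₁ d k → d ℕ.^ 2 ℕ.≤ 2 ℕ.* bound₁ d k × bound₁ d k ℕ.≤ 3 ℕ.* d ℕ.^ 2
  growth₁ (suc d) (suc r) (_ , k≤d , _) =
    bound₁-growth d r (ℕ.≤-trans (ℕ.n≤1+n r) (ℕ.≤-trans k≤d (ℕ.n≤1+n d)))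
  growth₁ zero (suc r) (_ , () , _)

  part₂ : ∀ d k → 2 ℕ.≤ k → k ℕ.< d →
    (∃ λ m → IsMinSa em d (d ℕ.+ k) m × m ℕ.≤ bound₂ d k) × bound₂ d k ≡ bound₂′ d k
  part₂ d k 2≤k k<d with m , refl ← split-dimension k<d =
    upper-bound₂ (suc m) k (ℕ.<⇒≤ 2≤k) , ≡.trans (bound₂≡ (suc m) k) (≡.sym (bound₂′≡ (suc m) k))

  growth₂ : ∀ d k → 2 ℕ.≤ k → k ℕ.< d →
    (d ∸ k) ℕ.* d ℕ.≤ 2 ℕ.* bound₂′ d k × bound₂′ d k ℕ.≤ 5 ℕ.* ((d ∸ k) ℕ.* d)
  growth₂ d k 2≤k k<d with m , refl ← split-dimension k<d = bound₂′-growth m k (ℕ.<⇒≤ 2≤k)
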